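{- For all integers $n \geq 0$ and $k\ge 1$ and all real $x$, $$c_n^{(k)}(x) = \sum_{m=0}^n \frac{(-1)^{n-m}}{(m+1)^k} \genfrac{[}{]}{0pt}{}{n}{m}_x$$ and $$\widehat{c}_n^{(k)}(-x) = (-1)^n \sum_{m=0}^n \frac{1}{(m+1)^k} \genfrac{[}{]}{0pt}{}{n}{m}_x.$$
   Context: For real $z$ and integer $n\ge 0$, $\binom{z}{n} = \frac{z(z-1)\cdots(z-n+1)}{n!}$. For integers $n\ge0$, $k\ge1$, the poly-Cauchy polynomials of the first and second kind are $$c_n^{(k)}(x) = n! \int_{0}^{1}\!\! \cdots \int_{0}^{1} \binom{t_1 \cdots t_k - x}{n}\,dt_1 \cdots dt_k,\qquad \widehat{c}_n^{(k)}(x) = n! \int_{0}^{1}\!\! \cdots \int_{0}^{1} \binom{x - t_1 \cdots t_k}{n}\,dt_1 \cdots dt_k.$$ The generalized Stirling numbers of the first kind are $\genfrac{[}{]}{0pt}{}{n}{m}_x = \sum_{i=0}^{n-m} \binom{i+m}{m}\genfrac{[}{]}{0pt}{}{n}{i+m} x^i$ for $0 \leq m \leq n$ and $x\in\mathbb{R}$, where $\genfrac{[}{]}{0pt}{}{n}{m}$ are the unsigned Stirling numbers of the first kind and $x^0=1$. -}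

module Defs where

open import Algebra.Bundles using (RawRing)
import Algebra.Definitions.RawSemiring as RawSemiringDefs
open import Data.Fin.Base using (Fin; toℕ; inject₁; fromℕ) renaming (zero to fzero; suc to fsuc)
open import Data.Integer.Base as ℤ using (+_)
open import Data.Nat.Base as ℕ using (ℕ; zero; suc; _∸_; _⊔_; _!)
open import Data.Nat.Combinatorics using (_C_)
import Data.Nat.Properties as ℕ
open import Data.Product using (∃; _×_; _,_)
open import Data.Rational.Base as ℚ using (ℚ; 0ℚ; 1ℚ)
import Data.Rational.Properties as ℚ
open import Data.Rational.Solver using (module +-*-Solver)
open import Data.Vec.Functional using (Vector; []; _∷_)
open import Function using (_∘_)
open import Level using (0ℓ)
open import Relation.Binary.PropositionalEquality

-- Reals are Cauchy sequences of rationals, with _≈_ as their equality.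

Cauchy : (ℕ → ℚ) → Set
Cauchy u = ∀ ε → 0ℚ ℚ.< ε →
  ∃ λ N → ∀ {m n} → N ℕ.≤ m → N ℕ.≤ n → ℚ.∣ u m ℚ.- u n ∣ ℚ.≤ ε

record ℝ : Set where
  constructor mkℝ
  field
    seq    : ℕ → ℚ
    cauchy : Cauchy seq

open ℝ public

infix 4 _≈_ _≤_

_≈_ : ℝ → ℝ → Set
x ≈ y = ∀ ε → 0ℚ ℚ.< ε →
  ∃ λ N → ∀ {n} → N ℕ.≤ n → ℚ.∣ seq x n ℚ.- seq y n ∣ ℚ.≤ ε

-- The weak order; the slack ε makes it respect _≈_.
_≤_ : ℝ → ℝ → Set
x ≤ y = ∀ ε → 0ℚ ℚ.< ε →
  ∃ λ N → ∀ {n} → N ℕ.≤ n → seq x n ℚ.≤ seq y n ℚ.+ ε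

private
  open ℚ.≤-Reasoning

  half : ℚ
  half = + 1 ℚ./ 2

  0<*half : ∀ {ε} → 0ℚ ℚ.< ε → 0ℚ ℚ.< ε ℚ.* half
  0<*half {ε} 0<ε =
    ℚ.positive⁻¹ (ε ℚ.* half) {{ℚ.pos*pos⇒pos ε {{ℚ.positive 0<ε}} half}}

  halves : ∀ ε → ε ℚ.* half ℚ.+ ε ℚ.* half ≡ ε
  halves ε = trans (sym (ℚ.*-distribˡ-+ ε half half)) (ℚ.*-identityʳ ε)

  const-cauchy : ∀ q → Cauchy (λ _ → q)
  const-cauchy q ε 0<ε = 0 , λ _ _ → begin
    ℚ.∣ q ℚ.- q ∣ ≡⟨ cong ℚ.∣_∣ (ℚ.+-inverseʳ q) ⟩
    0ℚ            ≤⟨ ℚ.<⇒≤ 0<ε ⟩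
    ε             ∎

  +-cauchy : ∀ {u v} → Cauchy u → Cauchy v → Cauchy (λ n → u n ℚ.+ v n)
  +-cauchy {u} {v} cu cv ε 0<ε
    with cu (ε ℚ.* half) (0<*half 0<ε) | cv (ε ℚ.* half) (0<*half 0<ε)
  ... | M , hu | N , hv = M ⊔ N , λ {m} {n} m≥ n≥ → begin
    ℚ.∣ (u m ℚ.+ v m) ℚ.- (u n ℚ.+ v n) ∣
      ≡⟨ cong ℚ.∣_∣ (rearrange (u m) (v m) (u n) (v n)) ⟩
    ℚ.∣ (u m ℚ.- u n) ℚ.+ (v m ℚ.- v n) ∣
      ≤⟨ ℚ.∣p+q∣≤∣p∣+∣q∣ (u m ℚ.- u n) (v m ℚ.- v n) ⟩
    ℚ.∣ u m ℚ.- u n ∣ ℚ.+ ℚ.∣ v m ℚ.- v n ∣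
      ≤⟨ ℚ.+-mono-≤ (hu (ℕ.m⊔n≤o⇒m≤o M N m≥) (ℕ.m⊔n≤o⇒m≤o M N n≥))
                    (hv (ℕ.m⊔n≤o⇒n≤o M N m≥) (ℕ.m⊔n≤o⇒n≤o M N n≥)) ⟩
    ε ℚ.* half ℚ.+ ε ℚ.* half
      ≡⟨ halves ε ⟩
    ε ∎
    where
    open +-*-Solver
    rearrange : ∀ a b c d →
      (a ℚ.+ b) ℚ.- (c ℚ.+ d) ≡ (a ℚ.- c) ℚ.+ (b ℚ.- d)
    rearrange = solve 4 (λ a b c d →
      (a :+ b) :- (c :+ d) := (a :- c) :+ (b :- d)) refl

  neg-cauchy : ∀ {u} → Cauchy u → Cauchy (λ n → ℚ.- u n)
  neg-cauchy {u} cu ε 0<ε with cu ε 0<ε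
  ... | N , hu = N , λ {m} {n} m≥ n≥ → begin
    ℚ.∣ (ℚ.- u m) ℚ.- (ℚ.- u n) ∣ ≡⟨ cong ℚ.∣_∣ (sym (ℚ.neg-distrib-+ (u m) (ℚ.- u n))) ⟩
    ℚ.∣ ℚ.- (u m ℚ.- u n) ∣       ≡⟨ ℚ.∣-p∣≡∣p∣ (u m ℚ.- u n) ⟩
    ℚ.∣ u m ℚ.- u n ∣             ≤⟨ hu m≥ n≥ ⟩
    ε                             ∎

  ∣p∣≤∣p-q∣+∣q∣ : ∀ p q → ℚ.∣ p ∣ ℚ.≤ ℚ.∣ p ℚ.- q ∣ ℚ.+ ℚ.∣ q ∣
  ∣p∣≤∣p-q∣+∣q∣ p q = begin
    ℚ.∣ p ∣                     ≡⟨ cong ℚ.∣_∣ (cancel p q) ⟩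
    ℚ.∣ (p ℚ.- q) ℚ.+ q ∣       ≤⟨ ℚ.∣p+q∣≤∣p∣+∣q∣ (p ℚ.- q) q ⟩
    ℚ.∣ p ℚ.- q ∣ ℚ.+ ℚ.∣ q ∣   ∎
    where
    open +-*-Solver
    cancel : ∀ p q → p ≡ (p ℚ.- q) ℚ.+ q
    cancel = solve 2 (λ p q → p := (p :- q) :+ q) refl

  ∣p∣-∣q∣≤∣p-q∣ : ∀ p q → ℚ.∣ p ∣ ℚ.- ℚ.∣ q ∣ ℚ.≤ ℚ.∣ p ℚ.- q ∣
  ∣p∣-∣q∣≤∣p-q∣ p q = begin
    ℚ.∣ p ∣ ℚ.- ℚ.∣ q ∣
      ≤⟨ ℚ.+-monoˡ-≤ (ℚ.- ℚ.∣ q ∣) (∣p∣≤∣p-q∣+∣q∣ p q) ⟩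
    (ℚ.∣ p ℚ.- q ∣ ℚ.+ ℚ.∣ q ∣) ℚ.- ℚ.∣ q ∣
      ≡⟨ cancel ℚ.∣ p ℚ.- q ∣ ℚ.∣ q ∣ ⟩
    ℚ.∣ p ℚ.- q ∣ ∎
    where
    open +-*-Solver
    cancel : ∀ a b → (a ℚ.+ b) ℚ.- b ≡ a
    cancel = solve 2 (λ a b → (a :+ b) :- b := a) refl

  neg-swap : ∀ a b → ℚ.- (a ℚ.- b) ≡ b ℚ.- a
  neg-swap = solve 2 (λ a b → :- (a :- b) := b :- a) refl
    where open +-*-Solver

  ∣-∣-cauchy : ∀ {u} → Cauchy u → Cauchy (λ n → ℚ.∣ u n ∣)
  ∣-∣-cauchy {u} cu ε 0<ε with cu ε 0<ε
  ... | N , hu = N , λ {m} {n} m≥ n≥ → bound m n (hu m≥ n≥) (hu n≥ m≥)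
    where
    open import Data.Sum using (inj₁; inj₂)
    bound : ∀ m n → ℚ.∣ u m ℚ.- u n ∣ ℚ.≤ ε → ℚ.∣ u n ℚ.- u m ∣ ℚ.≤ ε →
            ℚ.∣ ℚ.∣ u m ∣ ℚ.- ℚ.∣ u n ∣ ∣ ℚ.≤ ε
    bound m n p q with ℚ.∣p∣≡p∨∣p∣≡-p (ℚ.∣ u m ∣ ℚ.- ℚ.∣ u n ∣)
    ... | inj₁ e = begin
      ℚ.∣ ℚ.∣ u m ∣ ℚ.- ℚ.∣ u n ∣ ∣ ≡⟨ e ⟩
      ℚ.∣ u m ∣ ℚ.- ℚ.∣ u n ∣       ≤⟨ ∣p∣-∣q∣≤∣p-q∣ (u m) (u n) ⟩
      ℚ.∣ u m ℚ.- u n ∣             ≤⟨ p ⟩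
      ε                             ∎
    ... | inj₂ e = begin
      ℚ.∣ ℚ.∣ u m ∣ ℚ.- ℚ.∣ u n ∣ ∣   ≡⟨ e ⟩
      ℚ.- (ℚ.∣ u m ∣ ℚ.- ℚ.∣ u n ∣)   ≡⟨ neg-swap ℚ.∣ u m ∣ ℚ.∣ u n ∣ ⟩
      ℚ.∣ u n ∣ ℚ.- ℚ.∣ u m ∣         ≤⟨ ∣p∣-∣q∣≤∣p-q∣ (u n) (u m) ⟩
      ℚ.∣ u n ℚ.- u m ∣               ≤⟨ q ⟩
      ε                               ∎

  eventually-bounded : ∀ {u} → Cauchy u →
    ∃ λ B → 0ℚ ℚ.< B × ∃ λ N → ∀ {n} → N ℕ.≤ n → ℚ.∣ u n ∣ ℚ.≤ B
  eventually-bounded {u} cu with cu 1ℚ (ℚ.positive⁻¹ 1ℚ)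
  ... | N , hu =
      1ℚ ℚ.+ ℚ.∣ u N ∣
    , ℚ.+-mono-<-≤ (ℚ.positive⁻¹ 1ℚ) (ℚ.0≤∣p∣ (u N))
    , N , λ {n} n≥ → begin
        ℚ.∣ u n ∣                          ≤⟨ ∣p∣≤∣p-q∣+∣q∣ (u n) (u N) ⟩
        ℚ.∣ u n ℚ.- u N ∣ ℚ.+ ℚ.∣ u N ∣    ≤⟨ ℚ.+-monoˡ-≤ ℚ.∣ u N ∣ (hu n≥ ℕ.≤-refl) ⟩
        1ℚ ℚ.+ ℚ.∣ u N ∣                   ∎

  ∣*∣-mono : ∀ {p q a b} → 0ℚ ℚ.< a → ℚ.∣ p ∣ ℚ.≤ a → ℚ.∣ q ∣ ℚ.≤ b →
             ℚ.∣ p ℚ.* q ∣ ℚ.≤ a ℚ.* b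
  ∣*∣-mono {p} {q} {a} {b} 0<a p≤a q≤b = begin
    ℚ.∣ p ℚ.* q ∣       ≡⟨ ℚ.∣p*q∣≡∣p∣*∣q∣ p q ⟩
    ℚ.∣ p ∣ ℚ.* ℚ.∣ q ∣ ≤⟨ ℚ.*-monoʳ-≤-nonNeg ℚ.∣ q ∣ {{ℚ.nonNegative (ℚ.0≤∣p∣ q)}} p≤a ⟩
    a ℚ.* ℚ.∣ q ∣       ≤⟨ ℚ.*-monoˡ-≤-nonNeg a {{ℚ.nonNegative (ℚ.<⇒≤ 0<a)}} q≤b ⟩
    a ℚ.* b             ∎

  *-split : ∀ a b c d →
    a ℚ.* b ℚ.- c ℚ.* d ≡ a ℚ.* (b ℚ.- d) ℚ.+ d ℚ.* (a ℚ.- c)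
  *-split a b c d = sym (begin-equality
    a ℚ.* (b ℚ.- d) ℚ.+ d ℚ.* (a ℚ.- c)
      ≡⟨ cong₂ ℚ._+_ (*-distribˡ-- a b d) (*-distribˡ-- d a c) ⟩
    (a ℚ.* b ℚ.- a ℚ.* d) ℚ.+ (d ℚ.* a ℚ.- d ℚ.* c)
      ≡⟨ cong₂ (λ p q → (a ℚ.* b ℚ.- a ℚ.* d) ℚ.+ (p ℚ.- q)) (ℚ.*-comm d a) (ℚ.*-comm d c) ⟩
    (a ℚ.* b ℚ.- a ℚ.* d) ℚ.+ (a ℚ.* d ℚ.- c ℚ.* d)
      ≡⟨ telescope (a ℚ.* b) (a ℚ.* d) (c ℚ.* d) ⟩
    a ℚ.* b ℚ.- c ℚ.* d ∎)
    where
    *-distribˡ-- : ∀ p q r → p ℚ.* (q ℚ.- r) ≡ p ℚ.* q ℚ.- p ℚ.* r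
    *-distribˡ-- p q r = trans (ℚ.*-distribˡ-+ p q (ℚ.- r))
                               (cong (p ℚ.* q ℚ.+_) (sym (ℚ.neg-distribʳ-* p r)))

    telescope : ∀ p q r → (p ℚ.- q) ℚ.+ (q ℚ.- r) ≡ p ℚ.- r
    telescope = solve 3 (λ p q r → (p :- q) :+ (q :- r) := p :- r) refl
      where open +-*-Solver

  share : ∀ {a b ε} → 0ℚ ℚ.< a → 0ℚ ℚ.< b → 0ℚ ℚ.< ε →
          ∃ λ η → 0ℚ ℚ.< η × a ℚ.* η ℚ.+ b ℚ.* η ≡ ε
  share {a} {b} {ε} 0<a 0<b 0<ε = scale (a ℚ.+ b) refl
    (ℚ.pos+pos⇒pos a {{ℚ.positive 0<a}} b {{ℚ.positive 0<b}})
    where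
    scale : ∀ c → a ℚ.+ b ≡ c → ℚ.Positive c →
            ∃ λ η → 0ℚ ℚ.< η × a ℚ.* η ℚ.+ b ℚ.* η ≡ ε
    scale c a+b≡c c-pos = η , 0<η , (begin-equality
      a ℚ.* η ℚ.+ b ℚ.* η   ≡⟨ sym (ℚ.*-distribʳ-+ η a b) ⟩
      (a ℚ.+ b) ℚ.* η       ≡⟨ cong (ℚ._* η) a+b≡c ⟩
      c ℚ.* η               ≡⟨ ℚ.*-comm c η ⟩
      (ε ℚ.* c⁻¹) ℚ.* c     ≡⟨ ℚ.*-assoc ε c⁻¹ c ⟩
      ε ℚ.* (c⁻¹ ℚ.* c)     ≡⟨ cong (ε ℚ.*_) (ℚ.*-inverseˡ c {{c≢0}}) ⟩
      ε ℚ.* 1ℚ              ≡⟨ ℚ.*-identityʳ ε ⟩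
      ε                     ∎)
      where
      c≢0 : ℚ.NonZero c
      c≢0 = ℚ.pos⇒nonZero c {{c-pos}}

      c⁻¹ η : ℚ
      c⁻¹ = (ℚ.1/ c) {{c≢0}}
      η = ε ℚ.* c⁻¹

      0<η : 0ℚ ℚ.< η
      0<η = ℚ.positive⁻¹ η {{ℚ.pos*pos⇒pos ε {{ℚ.positive 0<ε}} c⁻¹
                              {{ℚ.1/pos⇒pos c {{c-pos}}}}}}

  *-cauchy : ∀ {u v} → Cauchy u → Cauchy v → Cauchy (λ n → u n ℚ.* v n)
  *-cauchy {u} {v} cu cv ε 0<ε =
    let A , 0<A , Nᵘ , uA = eventually-bounded {u} cu
        B , 0<B , Nᵛ , vB = eventually-bounded {v} cv
        η , 0<η , budget = share {A} {B} {ε} 0<A 0<B 0<ε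
        M , hu = cu η 0<η
        N , hv = cv η 0<η
    in (Nᵘ ⊔ Nᵛ) ⊔ (M ⊔ N) , λ {m} {n} m≥ n≥ →
      let m≥₁ = ℕ.m⊔n≤o⇒m≤o (Nᵘ ⊔ Nᵛ) (M ⊔ N) m≥
          m≥₂ = ℕ.m⊔n≤o⇒n≤o (Nᵘ ⊔ Nᵛ) (M ⊔ N) m≥
          n≥₁ = ℕ.m⊔n≤o⇒m≤o (Nᵘ ⊔ Nᵛ) (M ⊔ N) n≥
          n≥₂ = ℕ.m⊔n≤o⇒n≤o (Nᵘ ⊔ Nᵛ) (M ⊔ N) n≥
      in product-bound {u m} {v m} {u n} {v n} 0<A 0<B budget
           (uA (ℕ.m⊔n≤o⇒m≤o Nᵘ Nᵛ m≥₁))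
           (vB (ℕ.m⊔n≤o⇒n≤o Nᵘ Nᵛ n≥₁))
           (hu (ℕ.m⊔n≤o⇒m≤o M N m≥₂) (ℕ.m⊔n≤o⇒m≤o M N n≥₂))
           (hv (ℕ.m⊔n≤o⇒n≤o M N m≥₂) (ℕ.m⊔n≤o⇒n≤o M N n≥₂))
    where
    product-bound : ∀ {a b c d A B η} → 0ℚ ℚ.< A → 0ℚ ℚ.< B →
      A ℚ.* η ℚ.+ B ℚ.* η ≡ ε → ℚ.∣ a ∣ ℚ.≤ A → ℚ.∣ d ∣ ℚ.≤ B →
      ℚ.∣ a ℚ.- c ∣ ℚ.≤ η → ℚ.∣ b ℚ.- d ∣ ℚ.≤ η →
      ℚ.∣ a ℚ.* b ℚ.- c ℚ.* d ∣ ℚ.≤ ε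
    product-bound {a} {b} {c} {d} {A} {B} {η} 0<A 0<B budget a≤ d≤ ac≤ bd≤ = begin
      ℚ.∣ a ℚ.* b ℚ.- c ℚ.* d ∣
        ≡⟨ cong ℚ.∣_∣ (*-split a b c d) ⟩
      ℚ.∣ a ℚ.* (b ℚ.- d) ℚ.+ d ℚ.* (a ℚ.- c) ∣
        ≤⟨ ℚ.∣p+q∣≤∣p∣+∣q∣ (a ℚ.* (b ℚ.- d)) (d ℚ.* (a ℚ.- c)) ⟩
      ℚ.∣ a ℚ.* (b ℚ.- d) ∣ ℚ.+ ℚ.∣ d ℚ.* (a ℚ.- c) ∣
        ≤⟨ ℚ.+-mono-≤ (∣*∣-mono {a} {b ℚ.- d} {A} {η} 0<A a≤ bd≤)
                      (∣*∣-mono {d} {a ℚ.- c} {B} {η} 0<B d≤ ac≤) ⟩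
      A ℚ.* η ℚ.+ B ℚ.* η
        ≡⟨ budget ⟩
      ε ∎

infixl 6 _+_ _-_
infixl 7 _*_
infix  8 -_

fromℚ : ℚ → ℝ
fromℚ q = mkℝ (λ _ → q) (const-cauchy q)

_+_ _*_ : ℝ → ℝ → ℝ
x + y = mkℝ (λ n → seq x n ℚ.+ seq y n) (+-cauchy {seq x} {seq y} (cauchy x) (cauchy y))
x * y = mkℝ (λ n → seq x n ℚ.* seq y n) (*-cauchy {seq x} {seq y} (cauchy x) (cauchy y))

-_ : ℝ → ℝ
-_ x = mkℝ (λ n → ℚ.- seq x n) (neg-cauchy {seq x} (cauchy x))

_-_ : ℝ → ℝ → ℝ
x - y = x + - y

∣_∣ : ℝ → ℝ
∣ x ∣ = mkℝ (λ n → ℚ.∣ seq x n ∣) (∣-∣-cauchy {seq x} (cauchy x))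

0ℝ 1ℝ : ℝ
0ℝ = fromℚ 0ℚ
1ℝ = fromℚ 1ℚ

natℝ : ℕ → ℝ
natℝ n = fromℚ (+ n ℚ./ 1)

1/ℕ : (d : ℕ) .{{_ : ℕ.NonZero d}} → ℝ
1/ℕ d = fromℚ (+ 1 ℚ./ d)

+-*-rawRing : RawRing 0ℓ 0ℓ
+-*-rawRing = record
  { Carrier = ℝ ; _≈_ = _≈_ ; _+_ = _+_ ; _*_ = _*_ ; -_ = -_ ; 0# = 0ℝ ; 1# = 1ℝ }

open RawSemiringDefs (RawRing.rawSemiring +-*-rawRing) public
  using (sum; product; _^_)

sum≤ : ℕ → (ℕ → ℝ) → ℝ
sum≤ n a = sum {suc n} (a ∘ toℕ)

infixl 6 sum≤
syntax sum≤ n (λ m → a) = Σ[ m ≤ n ] a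

_∈[0,1] : ℝ → Set
t ∈[0,1] = 0ℝ ≤ t × t ≤ 1ℝ

record TaggedPartition (r : ℕ) : Set where
  field
    point  : Fin (suc r) → ℝ
    tag    : Fin r → ℝ
    first  : point fzero ≈ 0ℝ
    last   : point (fromℕ r) ≈ 1ℝ
    lower  : ∀ i → point (inject₁ i) ≤ tag i
    upper  : ∀ i → tag i ≤ point (fsuc i)

  width : Fin r → ℝ
  width i = point (fsuc i) - point (inject₁ i)

open TaggedPartition public

riemannSum : ∀ {r} → (ℝ → ℝ) → TaggedPartition r → ℝ
riemannSum f P = sum λ i → f (tag P i) * width P i

-- f is Riemann integrable on [0,1] with integral I.
Integral₀¹ : (ℝ → ℝ) → ℝ → Set
Integral₀¹ f I = ∀ ε → 0ℚ ℚ.< ε → ∃ λ δ → 0ℚ ℚ.< δ ×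
  (∀ {r} (P : TaggedPartition r) → (∀ i → width P i ≤ fromℚ δ) →
   ∣ riemannSum f P - I ∣ ≤ fromℚ ε)

-- The iterated integral ∫₀¹⋯∫₀¹ f(t₁,…,tₖ) dt₁⋯dtₖ exists and equals I.
-- The head t₁ is integrated first; g is the resulting function of (t₂,…,tₖ),
-- whose values outside the cube are irrelevant.
IteratedIntegral : ∀ k → (Vector ℝ k → ℝ) → ℝ → Set
IteratedIntegral zero    f I = f [] ≈ I
IteratedIntegral (suc k) f I = ∃ λ (g : Vector ℝ k → ℝ) →
  (∀ ts → (∀ i → ts i ∈[0,1]) → Integral₀¹ (λ t → f (t ∷ ts)) (g ts)) ×
  IteratedIntegral k g I

fallingFactorial : ℝ → ℕ → ℝ
fallingFactorial z n = product {n} λ i → z - natℝ (toℕ i)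

binomial : ℝ → ℕ → ℝ
binomial z n = fallingFactorial z n * 1/ℕ (n !) {{n ℕ.!≢0}}

-- The poly-Cauchy polynomials of the first and second kind are given by their
-- graphs: c is the value n! ∫₀¹⋯∫₀¹ … dt₁⋯dtₖ, the integral being required to
-- exist.
IsPolyCauchy₁ : (n k : ℕ) (x c : ℝ) → Set
IsPolyCauchy₁ n k x c = ∃ λ I →
  IteratedIntegral k (λ t → binomial (product t - x) n) I × c ≈ natℝ (n !) * I

IsPolyCauchy₂ : (n k : ℕ) (x c : ℝ) → Set
IsPolyCauchy₂ n k x c = ∃ λ I →
  IteratedIntegral k (λ t → binomial (x - product t) n) I × c ≈ natℝ (n !) * I

-- Unsigned.
stirling₁ : ℕ → ℕ → ℕ
stirling₁ zero    zero    = 1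
stirling₁ zero    (suc m) = 0
stirling₁ (suc n) zero    = 0
stirling₁ (suc n) (suc m) = n ℕ.* stirling₁ n (suc m) ℕ.+ stirling₁ n m

-- Meaningful for m ≤ n.
genStirling₁ : ℕ → ℕ → ℝ → ℝ
genStirling₁ n m x =
  Σ[ i ≤ n ∸ m ] natℝ (((i ℕ.+ m) C m) ℕ.* stirling₁ n (i ℕ.+ m)) * x ^ i

1/[1+_]^_ : ℕ → ℕ → ℝ
1/[1+ m ]^ k = 1/ℕ (suc m ℕ.^ k) {{ℕ.m^n≢0 (suc m) k}}

{-# OPTIONS --safe #-}

-- The product of the (z − i) for i < n is a polynomial in y both for z = y − x
-- and for z = −x − y, namely (−1)ⁿ times the rising factorial of x − y or of
-- x + y.  The coefficient of yᵐ in the rising factorial of x + y is the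
-- generalised Stirling number, because both satisfy the recursion
-- [n+1, m+1] = (x + n) [n, m+1] + [n, m].  With y = t₁⋯tₖ the integral is then
-- taken term by term, each variable contributing a factor 1/(m+1) to the term of
-- degree m.
-- The integral of tᵐ rests on the bounds aᵐ(b−a) ≤ (bᵐ⁺¹−aᵐ⁺¹)/(m+1) ≤ bᵐ(b−a),
-- so that the error of a Riemann sum of mesh δ telescopes to at most δ.

module Submission where

import Algebra.Definitions.RawSemiring as RawSemiringDefs
import Algebra.Properties.CommutativeSemiring.Exp as CommutativeExp
import Algebra.Properties.Monoid.Sum as MonoidSum
import Algebra.Properties.Ring as RingProperties
import Algebra.Properties.Semiring.Exp as Exp
import Algebra.Properties.Semiring.Sum as SemiringSum
import Algebra.Solver.Ring as RingSolver
open import Algebra.Bundles using (CommutativeRing; Monoid; RawRing)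
open import Algebra.Solver.Ring.AlmostCommutativeRing using (AlmostCommutativeRing; fromCommutativeRing; _-Raw-AlmostCommutative⟶_)
open import Algebra.Structures using (IsCommutativeRing)
open import Data.Fin.Base using (Fin; toℕ; inject₁) renaming (zero to fzero; suc to fsuc; fromℕ to flast)
open import Data.Fin.Properties using (toℕ-inject₁; toℕ-fromℕ; toℕ<n)
open import Data.Integer.Base as ℤ using (+_; -[1+_])
import Data.Integer.Properties as ℤ
open import Data.Integer.Solver using () renaming (module +-*-Solver to ℤ-Solver)
import Data.Maybe.Base as Maybe
open import Data.Nat.Base as ℕ using (ℕ; zero; suc; _∸_; _⊔_; _!) renaming (_≤_ to _≤ℕ_)
open import Data.Nat.Combinatorics using (_C_; nCk+nC[k+1]≡[n+1]C[k+1]; k>n⇒nCk≡0)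
import Data.Nat.Properties as ℕ
open import Data.Nat.Solver using () renaming (module +-*-Solver to ℕ-Solver)
open import Data.Product using (∃; _×_; _,_)
open import Data.Rational.Base as ℚ using (ℚ; mkℚ; 0ℚ; 1ℚ; ½)
import Data.Rational.Properties as ℚ
open import Data.Rational.Solver using () renaming (module +-*-Solver to ℚ-Solver)
open import Data.Rational.Unnormalised.Base as ℚᵘ using (mkℚᵘ; *≡*; *≤*)
import Data.Rational.Unnormalised.Properties as ℚᵘ
open import Data.Sum.Base using (inj₁; inj₂)
open import Data.Vec.Functional using (Vector; []; _∷_)
open import Function.Base using (_∘_)
open import Function.Bundles using (_⇔_; mk⇔)
open import Level using (0ℓ)
open import Relation.Binary.Bundles using (Poset)
open import Relation.Binary.PropositionalEquality as ≡ using (_≡_)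
open import Relation.Binary.Structures using (IsPartialOrder; IsEquivalence)
open import Relation.Nullary.Decidable using (dec⇒maybe)
import Defs as ℝ
open ℝ using (stirling₁)

-- A poly-Cauchy value is given by a graph, so each formula is an equivalence: one direction
-- produces the iterated integral, the other needs it to be unique. The functions of the later
-- variables that witness an iterated integral are determined only on the cube and only up to `_≈_`,
-- and this shapes both halves. Existence takes every inner function to be a polynomial in the
-- product of the remaining variables. Uniqueness compares two integrands that agree on [0,1],
-- through one partition whose tags lie in [0,1]. The order of the reals is undecidable, so no
-- argument about reals splits on a sign. The absolute value is handled as the least upper bound of
-- x and -x, and a polynomial with coefficients of mixed sign has its error controlled by the
-- polynomial with their absolute values as coefficients, which is monotone on [0,∞).

-- Rational arithmetic: naturals, reciprocals, the Archimedean property.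

fromℕ : ℕ → ℚ
fromℕ n = + n ℚ./ 1

-- `+ n ℚ./ 1` is normalised by a gcd that does not compute for a variable `n`, so the equation is
-- checked among unnormalised rationals.
fromℕ-suc : ∀ n → fromℕ (suc n) ≡ 1ℚ ℚ.+ fromℕ n
fromℕ-suc n = ℚ.toℚᵘ-injective (begin
  ℚ.toℚᵘ (fromℕ (suc n))              ≈⟨ ℚ.toℚᵘ-fromℚᵘ (mkℚᵘ (+ suc n) 0) ⟩
  mkℚᵘ (+ suc n) 0                    ≈⟨ *≡* (one+n (+ n)) ⟩
  mkℚᵘ (+ 1) 0 ℚᵘ.+ mkℚᵘ (+ n) 0      ≈⟨ ℚᵘ.+-congʳ (mkℚᵘ (+ 1) 0) (ℚ.toℚᵘ-fromℚᵘ (mkℚᵘ (+ n) 0)) ⟨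
  ℚ.toℚᵘ 1ℚ ℚᵘ.+ ℚ.toℚᵘ (fromℕ n)     ≈⟨ ℚ.toℚᵘ-homo-+ 1ℚ (fromℕ n) ⟨
  ℚ.toℚᵘ (1ℚ ℚ.+ fromℕ n)             ∎)
  where
  open ℚᵘ.≃-Reasoning
  one+n : ∀ n → (+ 1 ℤ.+ n) ℤ.* + 1 ≡ (+ 1 ℤ.+ n ℤ.* + 1) ℤ.* + 1
  one+n = solve 1 (λ n → (con (+ 1) :+ n) :* con (+ 1) := (con (+ 1) :+ n :* con (+ 1)) :* con (+ 1)) ≡.refl
    where open ℤ-Solver

recip*fromℕ : ∀ d .{{_ : ℕ.NonZero d}} → (+ 1 ℚ./ d) ℚ.* fromℕ d ≡ 1ℚ
recip*fromℕ (suc d) = ℚ.toℚᵘ-injective (begin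
  ℚ.toℚᵘ ((+ 1 ℚ./ suc d) ℚ.* fromℕ (suc d))
    ≈⟨ ℚ.toℚᵘ-homo-* (+ 1 ℚ./ suc d) (fromℕ (suc d)) ⟩
  ℚ.toℚᵘ (+ 1 ℚ./ suc d) ℚᵘ.* ℚ.toℚᵘ (fromℕ (suc d))
    ≈⟨ ℚᵘ.*-cong (ℚ.toℚᵘ-fromℚᵘ (mkℚᵘ (+ 1) d)) (ℚ.toℚᵘ-fromℚᵘ (mkℚᵘ (+ suc d) 0)) ⟩
  mkℚᵘ (+ 1) d ℚᵘ.* mkℚᵘ (+ suc d) 0
    ≈⟨ *≡* (cancel (+ suc d)) ⟩
  mkℚᵘ (+ 1) 0 ∎)
  where
  open ℚᵘ.≃-Reasoning
  cancel : ∀ d → (+ 1 ℤ.* d) ℤ.* + 1 ≡ + 1 ℤ.* (d ℤ.* + 1)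
  cancel = solve 1 (λ d → (con (+ 1) :* d) :* con (+ 1) := con (+ 1) :* (d :* con (+ 1))) ≡.refl
    where open ℤ-Solver

0≤recip : ∀ d .{{_ : ℕ.NonZero d}} → 0ℚ ℚ.≤ (+ 1 ℚ./ d)
0≤recip d = ℚ.nonNegative⁻¹ (+ 1 ℚ./ d) {{ℚ.normalize-nonNeg 1 d}}

-- A positive fraction is at least the reciprocal of its own denominator, and that denominator is
-- the witness.
archimedean : ∀ {δ} → 0ℚ ℚ.< δ → ∃ λ d → (+ 1 ℚ./ suc d) ℚ.≤ δ
archimedean {mkℚ (+ zero) d c} (ℚ.*<* (ℤ.+<+ ()))
archimedean {δ@(mkℚ (+ suc n) d c)} _ = d , ℚ.toℚᵘ-cancel-≤ (begin
  ℚ.toℚᵘ (+ 1 ℚ./ suc d)  ≃⟨ ℚ.toℚᵘ-fromℚᵘ (mkℚᵘ (+ 1) d) ⟩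
  mkℚᵘ (+ 1) d            ≤⟨ *≤* (ℤ.*-monoʳ-≤-nonNeg (+ suc d) (ℤ.+≤+ (ℕ.s≤s (ℕ.z≤n {n})))) ⟩
  mkℚᵘ (+ suc n) d        ∎)
  where open ℚᵘ.≤-Reasoning
archimedean {mkℚ -[1+ n ] d c} (ℚ.*<* ())

divide : ∀ {c ε} → 0ℚ ℚ.< c → 0ℚ ℚ.< ε → ∃ λ η → 0ℚ ℚ.< η × c ℚ.* η ≡ ε
divide {c} {ε} 0<c 0<ε = c⁻¹ ℚ.* ε , 0<η , (begin
  c ℚ.* (c⁻¹ ℚ.* ε) ≡⟨ ℚ.*-assoc c c⁻¹ ε ⟨
  (c ℚ.* c⁻¹) ℚ.* ε ≡⟨ ≡.cong (ℚ._* ε) (ℚ.*-inverseʳ c {{c≢0}}) ⟩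
  1ℚ ℚ.* ε          ≡⟨ ℚ.*-identityˡ ε ⟩
  ε                 ∎)
  where
  open ≡.≡-Reasoning

  c≢0 : ℚ.NonZero c
  c≢0 = ℚ.pos⇒nonZero c {{ℚ.positive 0<c}}

  c⁻¹ : ℚ
  c⁻¹ = (ℚ.1/ c) {{c≢0}}

  0<η : 0ℚ ℚ.< c⁻¹ ℚ.* ε
  0<η = ℚ.positive⁻¹ (c⁻¹ ℚ.* ε) {{ℚ.pos*pos⇒pos c⁻¹
    {{ℚ.1/pos⇒pos c {{ℚ.positive 0<c}}}} ε {{ℚ.positive 0<ε}}}}

-- Two bounds at once, because uniqueness of the integral has to respect the mesh demanded by each
-- of two integrals.
archimedean₂ : ∀ {δ δ′} → 0ℚ ℚ.< δ → 0ℚ ℚ.< δ′ →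
  ∃ λ d → (+ 1 ℚ./ suc d) ℚ.≤ δ × (+ 1 ℚ./ suc d) ℚ.≤ δ′
archimedean₂ {δ} {δ′} 0<δ 0<δ′ with ℚ.≤-total δ δ′
... | inj₁ δ≤δ′ = let d , d≤δ = archimedean 0<δ in d , d≤δ , ℚ.≤-trans d≤δ δ≤δ′
... | inj₂ δ′≤δ = let d , d≤δ′ = archimedean 0<δ′ in d , ℚ.≤-trans d≤δ′ δ′≤δ , d≤δ′

-- The interface through which the reals are used. The three laws for the absolute value make it the
-- least upper bound of `x` and `- x`. `bounded` supplies rational bounds, from which a rational
-- mesh can be computed, and `≤-closed` allows an inequality to be proved up to every positive
-- rational.
record IsOrderedℚAlgebra {A : Set} (_≈_ _≤_ : A → A → Set)
    (_+_ _*_ : A → A → A) (-_ ∣_∣ : A → A) (0# 1# : A) (fromℚ : ℚ → A) : Set where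
  field
    isCommutativeRing : IsCommutativeRing _≈_ _+_ _*_ -_ 0# 1#
    isPartialOrder    : IsPartialOrder _≈_ _≤_
    +-mono-≤          : ∀ {x y u v} → x ≤ y → u ≤ v → (x + u) ≤ (y + v)
    *-nonneg          : ∀ {x y} → 0# ≤ x → 0# ≤ y → 0# ≤ (x * y)
    x≤∣x∣             : ∀ x → x ≤ ∣ x ∣
    -x≤∣x∣            : ∀ x → (- x) ≤ ∣ x ∣
    ∣∣-least          : ∀ {x y} → x ≤ y → (- x) ≤ y → ∣ x ∣ ≤ y
    fromℚ-0           : fromℚ 0ℚ ≈ 0#
    fromℚ-1           : fromℚ 1ℚ ≈ 1#
    fromℚ-+           : ∀ p q → fromℚ (p ℚ.+ q) ≈ (fromℚ p + fromℚ q)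
    fromℚ-*           : ∀ p q → fromℚ (p ℚ.* q) ≈ (fromℚ p * fromℚ q)
    fromℚ-mono-≤      : ∀ {p q} → p ℚ.≤ q → fromℚ p ≤ fromℚ q
    bounded           : ∀ x → ∃ λ q → 0ℚ ℚ.< q × x ≤ fromℚ q
    ≤-closed          : ∀ {x y} → (∀ ε → 0ℚ ℚ.< ε → x ≤ (y + fromℚ ε)) → x ≤ y

-- The Cauchy reals form an ordered ℚ-algebra.

module ℝ-Properties where
  open ℝ using (ℝ; seq; cauchy; fromℚ; 0ℝ; 1ℝ)
  open ℚ.≤-Reasoning

  p≤∣p∣ : ∀ p → p ℚ.≤ ℚ.∣ p ∣
  p≤∣p∣ p with ℚ.≤-total 0ℚ p
  ... | inj₁ 0≤p = ℚ.≤-reflexive (≡.sym (ℚ.0≤p⇒∣p∣≡p 0≤p))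
  ... | inj₂ p≤0 = ℚ.≤-trans p≤0 (ℚ.0≤∣p∣ p)

  -p≤∣p∣ : ∀ p → ℚ.- p ℚ.≤ ℚ.∣ p ∣
  -p≤∣p∣ p = ≡.subst (ℚ.- p ℚ.≤_) (ℚ.∣-p∣≡∣p∣ p) (p≤∣p∣ (ℚ.- p))

  ∣p∣≤q : ∀ {p q} → p ℚ.≤ q → ℚ.- p ℚ.≤ q → ℚ.∣ p ∣ ℚ.≤ q
  ∣p∣≤q {p} {q} p≤q -p≤q with ℚ.∣p∣≡p∨∣p∣≡-p p
  ... | inj₁ e = ≡.subst (ℚ._≤ q) (≡.sym e) p≤q
  ... | inj₂ e = ≡.subst (ℚ._≤ q) (≡.sym e) -p≤q

  p-q+q : ∀ p q → (p ℚ.- q) ℚ.+ q ≡ p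
  p-q+q = solve 2 (λ p q → (p :- q) :+ q := p) ≡.refl
    where open ℚ-Solver

  p-q≤r⇒p≤q+r : ∀ {p q r} → p ℚ.- q ℚ.≤ r → p ℚ.≤ q ℚ.+ r
  p-q≤r⇒p≤q+r {p} {q} {r} h = begin
    p                   ≡⟨ p-q+q p q ⟨
    (p ℚ.- q) ℚ.+ q     ≤⟨ ℚ.+-monoˡ-≤ q h ⟩
    r ℚ.+ q             ≡⟨ ℚ.+-comm r q ⟩
    q ℚ.+ r             ∎

  p≤q+r⇒p-q≤r : ∀ {p q r} → p ℚ.≤ q ℚ.+ r → p ℚ.- q ℚ.≤ r
  p≤q+r⇒p-q≤r {p} {q} {r} h = begin
    p ℚ.- q             ≤⟨ ℚ.+-monoˡ-≤ (ℚ.- q) h ⟩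
    (q ℚ.+ r) ℚ.- q     ≡⟨ cancel q r ⟩
    r                   ∎
    where
    cancel : ∀ q r → (q ℚ.+ r) ℚ.- q ≡ r
    cancel = solve 2 (λ q r → (q :+ r) :- q := r) ≡.refl
      where open ℚ-Solver

  neg-swap : ∀ p q → ℚ.- (p ℚ.- q) ≡ q ℚ.- p
  neg-swap = solve 2 (λ p q → :- (p :- q) := q :- p) ≡.refl
    where open ℚ-Solver

  half : ∀ {ε} → 0ℚ ℚ.< ε → 0ℚ ℚ.< ε ℚ.* ½
  half {ε} 0<ε = ℚ.positive⁻¹ (ε ℚ.* ½) {{ℚ.pos*pos⇒pos ε {{ℚ.positive 0<ε}} ½}}

  halves : ∀ ε → ε ℚ.* ½ ℚ.+ ε ℚ.* ½ ≡ ε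
  halves ε = ≡.trans (≡.sym (ℚ.*-distribˡ-+ ε ½ ½)) (ℚ.*-identityʳ ε)

  max≤ : ∀ {M N n} → M ⊔ N ℕ.≤ n → M ℕ.≤ n × N ℕ.≤ n
  max≤ {M} {N} h = ℕ.m⊔n≤o⇒m≤o M N h , ℕ.m⊔n≤o⇒n≤o M N h

  -- ≈ and ≤ unfold to function types, from which Agda cannot recover the reals
  -- that they relate, hence the explicit arguments.
  ≈-pointwise : ∀ x y → (∀ n → seq x n ≡ seq y n) → x ℝ.≈ y
  ≈-pointwise x y h ε 0<ε = 0 , λ {n} _ → begin
    ℚ.∣ seq x n ℚ.- seq y n ∣ ≡⟨ ≡.cong (λ q → ℚ.∣ q ℚ.- seq y n ∣) (h n) ⟩
    ℚ.∣ seq y n ℚ.- seq y n ∣ ≡⟨ ≡.cong ℚ.∣_∣ (ℚ.+-inverseʳ (seq y n)) ⟩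
    0ℚ                        ≤⟨ ℚ.<⇒≤ 0<ε ⟩
    ε                         ∎

  ≤-eventually : ∀ x y → (∃ λ N → ∀ {n} → N ℕ.≤ n → seq x n ℚ.≤ seq y n) → x ℝ.≤ y
  ≤-eventually x y (N , h) ε 0<ε = N , λ {n} N≤n →
    p-q≤r⇒p≤q+r {seq x n} {seq y n} (begin
      seq x n ℚ.- seq y n  ≤⟨ ℚ.+-monoˡ-≤ (ℚ.- seq y n) (h N≤n) ⟩
      seq y n ℚ.- seq y n  ≡⟨ ℚ.+-inverseʳ (seq y n) ⟩
      0ℚ                   ≤⟨ ℚ.<⇒≤ 0<ε ⟩
      ε                    ∎)

  ≤-pointwise : ∀ x y → (∀ n → seq x n ℚ.≤ seq y n) → x ℝ.≤ y
  ≤-pointwise x y h = ≤-eventually x y (0 , λ {n} _ → h n)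

  ≈⇒≤ : ∀ x y → x ℝ.≈ y → x ℝ.≤ y
  ≈⇒≤ x y h ε 0<ε = let N , f = h ε 0<ε in N , λ {n} N≤n →
    p-q≤r⇒p≤q+r {seq x n} {seq y n} (ℚ.≤-trans (p≤∣p∣ (seq x n ℚ.- seq y n)) (f N≤n))

  ≈-sym : ∀ x y → x ℝ.≈ y → y ℝ.≈ x
  ≈-sym x y h ε 0<ε = let N , f = h ε 0<ε in N , λ {n} N≤n → begin
    ℚ.∣ seq y n ℚ.- seq x n ∣         ≡⟨ ≡.cong ℚ.∣_∣ (neg-swap (seq x n) (seq y n)) ⟨
    ℚ.∣ ℚ.- (seq x n ℚ.- seq y n) ∣   ≡⟨ ℚ.∣-p∣≡∣p∣ (seq x n ℚ.- seq y n) ⟩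
    ℚ.∣ seq x n ℚ.- seq y n ∣         ≤⟨ f N≤n ⟩
    ε                                 ∎

  ≤-antisym : ∀ x y → x ℝ.≤ y → y ℝ.≤ x → x ℝ.≈ y
  ≤-antisym x y h k ε 0<ε =
    let M , f = h ε 0<ε
        N , g = k ε 0<ε
    in M ⊔ N , λ {n} n≥ →
    let n≥M , n≥N = max≤ {M} {N} n≥ in
    ∣p∣≤q {seq x n ℚ.- seq y n} {ε}
      (p≤q+r⇒p-q≤r {seq x n} {seq y n} (f n≥M))
      (≡.subst (ℚ._≤ ε) (≡.sym (neg-swap (seq x n) (seq y n)))
        (p≤q+r⇒p-q≤r {seq y n} {seq x n} (g n≥N)))

  ≤-closed : ∀ x y → (∀ ε → 0ℚ ℚ.< ε → x ℝ.≤ (y ℝ.+ fromℚ ε)) → x ℝ.≤ y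
  ≤-closed x y h ε 0<ε =
    -- One half is spent as the tolerance in the hypothesis, the other as the slack inside `_≤_`.
    let N , f = h (ε ℚ.* ½) (half 0<ε) (ε ℚ.* ½) (half 0<ε) in N , λ {n} N≤n → begin
    seq x n                                  ≤⟨ f N≤n ⟩
    (seq y n ℚ.+ ε ℚ.* ½) ℚ.+ ε ℚ.* ½        ≡⟨ ℚ.+-assoc (seq y n) (ε ℚ.* ½) (ε ℚ.* ½) ⟩
    seq y n ℚ.+ (ε ℚ.* ½ ℚ.+ ε ℚ.* ½)        ≡⟨ ≡.cong (seq y n ℚ.+_) (halves ε) ⟩
    seq y n ℚ.+ ε                            ∎

  +-mono-≤ : ∀ x y u v → x ℝ.≤ y → u ℝ.≤ v → (x ℝ.+ u) ℝ.≤ (y ℝ.+ v)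
  +-mono-≤ x y u v h k ε 0<ε =
    let M , f = h (ε ℚ.* ½) (half 0<ε)
        N , g = k (ε ℚ.* ½) (half 0<ε)
    in M ⊔ N , λ {n} n≥ →
    let n≥M , n≥N = max≤ {M} {N} n≥ in begin
    seq x n ℚ.+ seq u n
      ≤⟨ ℚ.+-mono-≤ (f n≥M) (g n≥N) ⟩
    (seq y n ℚ.+ ε ℚ.* ½) ℚ.+ (seq v n ℚ.+ ε ℚ.* ½)
      ≡⟨ interchange (seq y n) (ε ℚ.* ½) (seq v n) (ε ℚ.* ½) ⟩
    (seq y n ℚ.+ seq v n) ℚ.+ (ε ℚ.* ½ ℚ.+ ε ℚ.* ½)
      ≡⟨ ≡.cong ((seq y n ℚ.+ seq v n) ℚ.+_) (halves ε) ⟩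
    (seq y n ℚ.+ seq v n) ℚ.+ ε ∎
    where
    interchange : ∀ a b c d → (a ℚ.+ b) ℚ.+ (c ℚ.+ d) ≡ (a ℚ.+ c) ℚ.+ (b ℚ.+ d)
    interchange = solve 4 (λ a b c d → (a :+ b) :+ (c :+ d) := (a :+ c) :+ (b :+ d)) ≡.refl
      where open ℚ-Solver

  ≤-trans : ∀ x y z → x ℝ.≤ y → y ℝ.≤ z → x ℝ.≤ z
  ≤-trans x y z h k ε 0<ε =
    let M , f = h (ε ℚ.* ½) (half 0<ε)
        N , g = k (ε ℚ.* ½) (half 0<ε)
    in M ⊔ N , λ {n} n≥ →
    let n≥M , n≥N = max≤ {M} {N} n≥ in begin
    seq x n                                  ≤⟨ f n≥M ⟩
    seq y n ℚ.+ ε ℚ.* ½                      ≤⟨ ℚ.+-monoˡ-≤ (ε ℚ.* ½) (g n≥N) ⟩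
    (seq z n ℚ.+ ε ℚ.* ½) ℚ.+ ε ℚ.* ½        ≡⟨ ℚ.+-assoc (seq z n) (ε ℚ.* ½) (ε ℚ.* ½) ⟩
    seq z n ℚ.+ (ε ℚ.* ½ ℚ.+ ε ℚ.* ½)        ≡⟨ ≡.cong (seq z n ℚ.+_) (halves ε) ⟩
    seq z n ℚ.+ ε                            ∎

  -- Antisymmetry reduces this to `≤-trans`, where ε has already been halved.
  ≈-trans : ∀ x y z → x ℝ.≈ y → y ℝ.≈ z → x ℝ.≈ z
  ≈-trans x y z h k = ≤-antisym x z
    (≤-trans x y z (≈⇒≤ x y h) (≈⇒≤ y z k))
    (≤-trans z y x (≈⇒≤ z y (≈-sym y z k)) (≈⇒≤ y x (≈-sym x y h)))

  +-cong : ∀ x y u v → x ℝ.≈ y → u ℝ.≈ v → (x ℝ.+ u) ℝ.≈ (y ℝ.+ v)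
  +-cong x y u v h k = ≤-antisym (x ℝ.+ u) (y ℝ.+ v)
    (+-mono-≤ x y u v (≈⇒≤ x y h) (≈⇒≤ u v k))
    (+-mono-≤ y x v u (≈⇒≤ y x (≈-sym x y h)) (≈⇒≤ v u (≈-sym u v k)))

  neg-cong : ∀ x y → x ℝ.≈ y → (ℝ.- x) ℝ.≈ (ℝ.- y)
  neg-cong x y h ε 0<ε = let N , f = h ε 0<ε in N , λ {n} N≤n → begin
    ℚ.∣ ℚ.- seq x n ℚ.- ℚ.- seq y n ∣   ≡⟨ ≡.cong ℚ.∣_∣ (ℚ.neg-distrib-+ (seq x n) (ℚ.- seq y n)) ⟨
    ℚ.∣ ℚ.- (seq x n ℚ.- seq y n) ∣     ≡⟨ ℚ.∣-p∣≡∣p∣ (seq x n ℚ.- seq y n) ⟩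
    ℚ.∣ seq x n ℚ.- seq y n ∣           ≤⟨ f N≤n ⟩
    ε                                   ∎

  eventually-bounded : ∀ x → ∃ λ B → 0ℚ ℚ.< B ×
    ∃ λ N → ∀ {n} → N ℕ.≤ n → ℚ.∣ seq x n ∣ ℚ.≤ B
  eventually-bounded x with cauchy x 1ℚ (ℚ.positive⁻¹ 1ℚ)
  ... | N , f =
      1ℚ ℚ.+ ℚ.∣ seq x N ∣
    , ℚ.+-mono-<-≤ (ℚ.positive⁻¹ 1ℚ) (ℚ.0≤∣p∣ (seq x N))
    , N , λ {n} N≤n → begin
        ℚ.∣ seq x n ∣
          ≡⟨ ≡.cong ℚ.∣_∣ (p-q+q (seq x n) (seq x N)) ⟨
        ℚ.∣ (seq x n ℚ.- seq x N) ℚ.+ seq x N ∣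
          ≤⟨ ℚ.∣p+q∣≤∣p∣+∣q∣ (seq x n ℚ.- seq x N) (seq x N) ⟩
        ℚ.∣ seq x n ℚ.- seq x N ∣ ℚ.+ ℚ.∣ seq x N ∣
          ≤⟨ ℚ.+-monoˡ-≤ ℚ.∣ seq x N ∣ (f N≤n ℕ.≤-refl) ⟩
        1ℚ ℚ.+ ℚ.∣ seq x N ∣ ∎

  bounded : ∀ x → ∃ λ q → 0ℚ ℚ.< q × x ℝ.≤ fromℚ q
  bounded x =
    let B , 0<B , N , f = eventually-bounded x in
    B , 0<B , ≤-eventually x (fromℚ B) (N , λ {n} N≤n → ℚ.≤-trans (p≤∣p∣ (seq x n)) (f N≤n))

  ∣p*q∣≤ : ∀ p q {A B} → 0ℚ ℚ.≤ A → ℚ.∣ p ∣ ℚ.≤ A → ℚ.∣ q ∣ ℚ.≤ B → ℚ.∣ p ℚ.* q ∣ ℚ.≤ A ℚ.* B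
  ∣p*q∣≤ p q {A} {B} 0≤A p≤A q≤B = begin
    ℚ.∣ p ℚ.* q ∣          ≡⟨ ℚ.∣p*q∣≡∣p∣*∣q∣ p q ⟩
    ℚ.∣ p ∣ ℚ.* ℚ.∣ q ∣    ≤⟨ ℚ.*-monoʳ-≤-nonNeg ℚ.∣ q ∣ {{ℚ.nonNegative (ℚ.0≤∣p∣ q)}} p≤A ⟩
    A ℚ.* ℚ.∣ q ∣          ≤⟨ ℚ.*-monoˡ-≤-nonNeg A {{ℚ.nonNegative 0≤A}} q≤B ⟩
    A ℚ.* B                ∎

  -- From some index on `x` is bounded by a rational `B`, so it suffices that `u` and `v` are within
  -- ε/B of each other.
  *-congˡ : ∀ x u v → u ℝ.≈ v → (x ℝ.* u) ℝ.≈ (x ℝ.* v)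
  *-congˡ x u v h ε 0<ε =
    let B , 0<B , M , f = eventually-bounded x
        η , 0<η , Bη≡ε = divide 0<B 0<ε
        N , g = h η 0<η
    in M ⊔ N , λ {n} n≥ →
    let n≥M , n≥N = max≤ {M} {N} n≥ in
    begin
    ℚ.∣ seq x n ℚ.* seq u n ℚ.- seq x n ℚ.* seq v n ∣
      ≡⟨ ≡.cong ℚ.∣_∣ (factor (seq x n) (seq u n) (seq v n)) ⟩
    ℚ.∣ seq x n ℚ.* (seq u n ℚ.- seq v n) ∣
      ≤⟨ ∣p*q∣≤ (seq x n) (seq u n ℚ.- seq v n) (ℚ.<⇒≤ 0<B) (f n≥M) (g n≥N) ⟩
    B ℚ.* η
      ≡⟨ Bη≡ε ⟩
    ε ∎
    where
    factor : ∀ a b c → a ℚ.* b ℚ.- a ℚ.* c ≡ a ℚ.* (b ℚ.- c)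
    factor = solve 3 (λ a b c → a :* b :- a :* c := a :* (b :- c)) ≡.refl
      where open ℚ-Solver

  *-comm : ∀ x y → (x ℝ.* y) ℝ.≈ (y ℝ.* x)
  *-comm x y = ≈-pointwise (x ℝ.* y) (y ℝ.* x) λ n → ℚ.*-comm (seq x n) (seq y n)

  *-cong : ∀ x y u v → x ℝ.≈ y → u ℝ.≈ v → (x ℝ.* u) ℝ.≈ (y ℝ.* v)
  *-cong x y u v h k =
    ≈-trans (x ℝ.* u) (x ℝ.* v) (y ℝ.* v) (*-congˡ x u v k)
      (≈-trans (x ℝ.* v) (v ℝ.* x) (y ℝ.* v) (*-comm x v)
        (≈-trans (v ℝ.* x) (v ℝ.* y) (y ℝ.* v) (*-congˡ v x y h) (*-comm v y)))

  -- The terms of a nonnegative real may themselves be negative by a vanishing amount. `∣ x ∣` is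
  -- the same real with nonnegative terms, which turns `*-nonneg` into a termwise statement.
  0≤x⇒x≈∣x∣ : ∀ x → 0ℝ ℝ.≤ x → x ℝ.≈ ℝ.∣ x ∣
  0≤x⇒x≈∣x∣ x h = ≤-antisym x ℝ.∣ x ∣
    (≤-pointwise x ℝ.∣ x ∣ λ n → p≤∣p∣ (seq x n))
    λ ε 0<ε → let N , f = h (ε ℚ.* ½) (half 0<ε) in N , λ {n} N≤n →
      bound (seq x n) ε (ℚ.<⇒≤ 0<ε) (f N≤n)
    where
    double : ∀ q r → q ℚ.+ (r ℚ.+ r) ≡ (q ℚ.+ r) ℚ.+ r
    double q r = ≡.sym (ℚ.+-assoc q r r)

    bound : ∀ q ε → 0ℚ ℚ.≤ ε → 0ℚ ℚ.≤ q ℚ.+ ε ℚ.* ½ → ℚ.∣ q ∣ ℚ.≤ q ℚ.+ ε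
    bound q ε 0≤ε 0≤q+η = ∣p∣≤q
      (begin
        q         ≡⟨ ℚ.+-identityʳ q ⟨
        q ℚ.+ 0ℚ  ≤⟨ ℚ.+-monoʳ-≤ q 0≤ε ⟩
        q ℚ.+ ε   ∎)
      -- The lower bound 0 ≤ q + ε/2 is used twice: -q ≤ ε/2 ≤ (q + ε/2) + ε/2.
      (begin
        ℚ.- q                      ≡⟨ ℚ.+-identityʳ (ℚ.- q) ⟨
        ℚ.- q ℚ.+ 0ℚ               ≤⟨ ℚ.+-monoʳ-≤ (ℚ.- q) 0≤q+η ⟩
        ℚ.- q ℚ.+ (q ℚ.+ ε ℚ.* ½)  ≡⟨ cancel q (ε ℚ.* ½) ⟩
        0ℚ ℚ.+ ε ℚ.* ½             ≤⟨ ℚ.+-monoˡ-≤ (ε ℚ.* ½) 0≤q+η ⟩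
        (q ℚ.+ ε ℚ.* ½) ℚ.+ ε ℚ.* ½ ≡⟨ double q (ε ℚ.* ½) ⟨
        q ℚ.+ (ε ℚ.* ½ ℚ.+ ε ℚ.* ½) ≡⟨ ≡.cong (q ℚ.+_) (halves ε) ⟩
        q ℚ.+ ε                    ∎)
      where
      cancel : ∀ q r → ℚ.- q ℚ.+ (q ℚ.+ r) ≡ 0ℚ ℚ.+ r
      cancel = solve 2 (λ q r → :- q :+ (q :+ r) := con 0ℚ :+ r) ≡.refl
        where open ℚ-Solver

  *-nonneg : ∀ x y → 0ℝ ℝ.≤ x → 0ℝ ℝ.≤ y → 0ℝ ℝ.≤ (x ℝ.* y)
  *-nonneg x y h k = ≤-trans 0ℝ (ℝ.∣ x ∣ ℝ.* ℝ.∣ y ∣) (x ℝ.* y)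
    (≤-pointwise 0ℝ (ℝ.∣ x ∣ ℝ.* ℝ.∣ y ∣) λ n →
      ≡.subst (0ℚ ℚ.≤_) (ℚ.∣p*q∣≡∣p∣*∣q∣ (seq x n) (seq y n)) (ℚ.0≤∣p∣ (seq x n ℚ.* seq y n)))
    (≈⇒≤ (ℝ.∣ x ∣ ℝ.* ℝ.∣ y ∣) (x ℝ.* y)
      (*-cong ℝ.∣ x ∣ x ℝ.∣ y ∣ y (≈-sym x ℝ.∣ x ∣ (0≤x⇒x≈∣x∣ x h)) (≈-sym y ℝ.∣ y ∣ (0≤x⇒x≈∣x∣ y k))))

  ∣∣-least : ∀ x y → x ℝ.≤ y → (ℝ.- x) ℝ.≤ y → ℝ.∣ x ∣ ℝ.≤ y
  ∣∣-least x y h k ε 0<ε =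
    let M , f = h ε 0<ε
        N , g = k ε 0<ε
    in M ⊔ N , λ n≥ →
    let n≥M , n≥N = max≤ {M} {N} n≥ in ∣p∣≤q (f n≥M) (g n≥N)

  ≈-refl : ∀ x → x ℝ.≈ x
  ≈-refl x = ≈-pointwise x x λ _ → ≡.refl

  ≈-isEquivalence : IsEquivalence ℝ._≈_
  ≈-isEquivalence = record
    { refl  = λ {x} → ≈-refl x
    ; sym   = λ {x y} → ≈-sym x y
    ; trans = λ {x y z} → ≈-trans x y z
    }

  ≤-isPartialOrder : IsPartialOrder ℝ._≈_ ℝ._≤_
  ≤-isPartialOrder = record
    { isPreorder = record
      { isEquivalence = ≈-isEquivalence
      ; reflexive     = λ {x y} → ≈⇒≤ x y
      ; trans         = λ {x y z} → ≤-trans x y z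
      }
    ; antisym = λ {x y} → ≤-antisym x y
    }

  +-*-isCommutativeRing : IsCommutativeRing ℝ._≈_ ℝ._+_ ℝ._*_ ℝ.-_ 0ℝ 1ℝ
  +-*-isCommutativeRing = record
    { isRing = record
      { +-isAbelianGroup = record
        { isGroup = record
          { isMonoid = record
            { isSemigroup = record
              { isMagma = record
                { isEquivalence = ≈-isEquivalence
                ; ∙-cong        = λ {x y u v} → +-cong x y u v
                }
              ; assoc = λ x y z → ≈-pointwise ((x ℝ.+ y) ℝ.+ z) (x ℝ.+ (y ℝ.+ z))
                  λ n → ℚ.+-assoc (seq x n) (seq y n) (seq z n)
              }
            ; identity =
                (λ x → ≈-pointwise (0ℝ ℝ.+ x) x λ n → ℚ.+-identityˡ (seq x n))
              , (λ x → ≈-pointwise (x ℝ.+ 0ℝ) x λ n → ℚ.+-identityʳ (seq x n))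
            }
          ; inverse =
              (λ x → ≈-pointwise ((ℝ.- x) ℝ.+ x) 0ℝ λ n → ℚ.+-inverseˡ (seq x n))
            , (λ x → ≈-pointwise (x ℝ.+ (ℝ.- x)) 0ℝ λ n → ℚ.+-inverseʳ (seq x n))
          ; ⁻¹-cong = λ {x y} → neg-cong x y
          }
        ; comm = λ x y → ≈-pointwise (x ℝ.+ y) (y ℝ.+ x) λ n → ℚ.+-comm (seq x n) (seq y n)
        }
      ; *-cong     = λ {x y u v} → *-cong x y u v
      ; *-assoc    = λ x y z → ≈-pointwise ((x ℝ.* y) ℝ.* z) (x ℝ.* (y ℝ.* z))
          λ n → ℚ.*-assoc (seq x n) (seq y n) (seq z n)
      ; *-identity =
          (λ x → ≈-pointwise (1ℝ ℝ.* x) x λ n → ℚ.*-identityˡ (seq x n))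
        , (λ x → ≈-pointwise (x ℝ.* 1ℝ) x λ n → ℚ.*-identityʳ (seq x n))
      ; distrib    =
          (λ x y z → ≈-pointwise (x ℝ.* (y ℝ.+ z)) ((x ℝ.* y) ℝ.+ (x ℝ.* z))
            λ n → ℚ.*-distribˡ-+ (seq x n) (seq y n) (seq z n))
        , (λ x y z → ≈-pointwise ((y ℝ.+ z) ℝ.* x) ((y ℝ.* x) ℝ.+ (z ℝ.* x))
            λ n → ℚ.*-distribʳ-+ (seq x n) (seq y n) (seq z n))
      }
    ; *-comm = *-comm
    }

  ℝ-isOrderedℚAlgebra :
    IsOrderedℚAlgebra ℝ._≈_ ℝ._≤_ ℝ._+_ ℝ._*_ ℝ.-_ ℝ.∣_∣ 0ℝ 1ℝ fromℚ
  ℝ-isOrderedℚAlgebra = record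
    { isCommutativeRing = +-*-isCommutativeRing
    ; isPartialOrder    = ≤-isPartialOrder
    ; +-mono-≤          = λ {x y u v} → +-mono-≤ x y u v
    ; *-nonneg          = λ {x y} → *-nonneg x y
    ; x≤∣x∣             = λ x → ≤-pointwise x ℝ.∣ x ∣ λ n → p≤∣p∣ (seq x n)
    ; -x≤∣x∣            = λ x → ≤-pointwise (ℝ.- x) ℝ.∣ x ∣ λ n → -p≤∣p∣ (seq x n)
    ; ∣∣-least          = λ {x y} → ∣∣-least x y
    ; fromℚ-0           = ≈-refl 0ℝ
    ; fromℚ-1           = ≈-refl 1ℝ
    ; fromℚ-+           = λ p q → ≈-refl (fromℚ (p ℚ.+ q))
    ; fromℚ-*           = λ p q → ≈-refl (fromℚ (p ℚ.* q))
    ; fromℚ-mono-≤      = λ {p q} p≤q → ≤-pointwise (fromℚ p) (fromℚ q) λ _ → p≤q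
    ; bounded           = bounded
    ; ≤-closed          = λ {x y} → ≤-closed x y
    }

-- Inequalities and absolute values in an ordered ℚ-algebra.

module OrderedℚAlgebra
    {A : Set} {_≃_ _≼_ : A → A → Set} {_⊕_ _⊗_ : A → A → A} {⊝_ ∣_∣ : A → A} {𝟘 𝟙 : A} {fromℚ : ℚ → A}
    (isOrderedℚAlgebra : IsOrderedℚAlgebra _≃_ _≼_ _⊕_ _⊗_ ⊝_ ∣_∣ 𝟘 𝟙 fromℚ) where

  open IsOrderedℚAlgebra isOrderedℚAlgebra

  commutativeRing : CommutativeRing 0ℓ 0ℓ
  commutativeRing = record { isCommutativeRing = isCommutativeRing }

  open CommutativeRing commutativeRing
    hiding (isCommutativeRing) renaming (trans to ≈-trans; sym to ≈-sym; refl to ≈-refl; reflexive to ≈-reflexive)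
  open RingProperties ring using () renaming (+-inverseˡ-unique to inverseˡ-unique)
  open Exp semiring using (_^_; ^-congˡ)
  open SemiringSum semiring using (sum; sum-cong-≋; *-distribʳ-sum)

  poset : Poset 0ℓ 0ℓ 0ℓ
  poset = record { isPartialOrder = isPartialOrder }

  open Poset poset using (_≤_) renaming (refl to ≤-refl; reflexive to ≤-reflexive; trans to ≤-trans; antisym to ≤-antisym)
  open import Relation.Binary.Reasoning.PartialOrder poset

  fromℚ-neg : ∀ q → fromℚ (ℚ.- q) ≈ - fromℚ q
  fromℚ-neg q = inverseˡ-unique (fromℚ (ℚ.- q)) (fromℚ q) (begin-equality
    fromℚ (ℚ.- q) + fromℚ q   ≈⟨ fromℚ-+ (ℚ.- q) q ⟨
    fromℚ (ℚ.- q ℚ.+ q)       ≡⟨ ≡.cong fromℚ (ℚ.+-inverseˡ q) ⟩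
    fromℚ 0ℚ                  ≈⟨ fromℚ-0 ⟩
    0#                        ∎)

  private
    almostCommutativeRing : AlmostCommutativeRing 0ℓ 0ℓ
    almostCommutativeRing = fromCommutativeRing commutativeRing

    fromℚ-morphism : ℚ.+-*-rawRing -Raw-AlmostCommutative⟶ almostCommutativeRing
    fromℚ-morphism = record
      { ⟦_⟧    = fromℚ
      ; +-homo = fromℚ-+
      ; *-homo = fromℚ-*
      ; -‿homo = fromℚ-neg
      ; 0-homo = fromℚ-0
      ; 1-homo = fromℚ-1
      }

  -- Coefficients are rationals embedded by `fromℚ`, so that constants such as ½ take part in the
  -- normalisation.
  open RingSolver ℚ.+-*-rawRing almostCommutativeRing fromℚ-morphism
    (λ p q → Maybe.map (≈-reflexive ∘ ≡.cong fromℚ) (dec⇒maybe (p ℚ.≟ q)))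
    using (solve; _:=_; _:+_; _:*_; _:-_; :-_; con)

  x≤y⇒0≤y-x : ∀ {x y} → x ≤ y → 0# ≤ y - x
  x≤y⇒0≤y-x {x} {y} x≤y = begin
    0#      ≈⟨ -‿inverseʳ x ⟨
    x - x   ≤⟨ +-mono-≤ x≤y ≤-refl ⟩
    y - x   ∎

  0≤y-x⇒x≤y : ∀ {x y} → 0# ≤ y - x → x ≤ y
  0≤y-x⇒x≤y {x} {y} h = begin
    x           ≈⟨ +-identityˡ x ⟨
    0# + x      ≤⟨ +-mono-≤ h ≤-refl ⟩
    y - x + x   ≈⟨ solve 2 (λ x y → y :- x :+ x := y) ≈-refl x y ⟩
    y           ∎

  *-monoˡ-≤ : ∀ {x y z} → 0# ≤ z → x ≤ y → z * x ≤ z * y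
  *-monoˡ-≤ {x} {y} {z} 0≤z x≤y = 0≤y-x⇒x≤y (begin
    0#              ≤⟨ *-nonneg 0≤z (x≤y⇒0≤y-x x≤y) ⟩
    z * (y - x)     ≈⟨ solve 3 (λ x y z → z :* (y :- x) := z :* y :- z :* x) ≈-refl x y z ⟩
    z * y - z * x   ∎)

  *-monoʳ-≤ : ∀ {x y z} → 0# ≤ z → x ≤ y → x * z ≤ y * z
  *-monoʳ-≤ {x} {y} {z} 0≤z x≤y = begin
    x * z   ≈⟨ *-comm x z ⟩
    z * x   ≤⟨ *-monoˡ-≤ 0≤z x≤y ⟩
    z * y   ≈⟨ *-comm z y ⟩
    y * z   ∎

  neg-antimono-≤ : ∀ {x y} → x ≤ y → - y ≤ - x
  neg-antimono-≤ {x} {y} x≤y = 0≤y-x⇒x≤y (begin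
    0#          ≤⟨ x≤y⇒0≤y-x x≤y ⟩
    y - x       ≈⟨ solve 2 (λ x y → y :- x := (:- x) :- (:- y)) ≈-refl x y ⟩
    - x - - y   ∎)

  fromℚ-nonneg : ∀ {q} → 0ℚ ℚ.≤ q → 0# ≤ fromℚ q
  fromℚ-nonneg {q} 0≤q = begin
    0#         ≈⟨ fromℚ-0 ⟨
    fromℚ 0ℚ   ≤⟨ fromℚ-mono-≤ 0≤q ⟩
    fromℚ q    ∎

  -- For claims that come out doubled, such as `0≤∣x∣`, where adding symmetric inequalities replaces
  -- a case distinction on the sign.
  halve : ∀ {x} → 0# ≤ x + x → 0# ≤ x
  halve {x} h = begin
    0#                   ≤⟨ *-nonneg (fromℚ-nonneg (ℚ.nonNegative⁻¹ ½)) h ⟩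
    fromℚ ½ * (x + x)    ≈⟨ solve 1 (λ x → con ½ :* (x :+ x) := x) ≈-refl x ⟩
    x                    ∎

  0≤∣x∣ : ∀ x → 0# ≤ ∣ x ∣
  0≤∣x∣ x = halve (begin
    0#               ≈⟨ -‿inverseʳ x ⟨
    x - x            ≤⟨ +-mono-≤ (x≤∣x∣ x) (-x≤∣x∣ x) ⟩
    ∣ x ∣ + ∣ x ∣    ∎)

  ∣∣-cong : ∀ {x y} → x ≈ y → ∣ x ∣ ≈ ∣ y ∣
  ∣∣-cong x≈y = ≤-antisym (half x≈y) (half (≈-sym x≈y))
    where
    half : ∀ {x y} → x ≈ y → ∣ x ∣ ≤ ∣ y ∣
    half {x} {y} e = ∣∣-least (≤-trans (≤-reflexive e) (x≤∣x∣ y))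
                              (≤-trans (≤-reflexive (-‿cong e)) (-x≤∣x∣ y))

  ∣x+y∣≤∣x∣+∣y∣ : ∀ x y → ∣ x + y ∣ ≤ ∣ x ∣ + ∣ y ∣
  ∣x+y∣≤∣x∣+∣y∣ x y = ∣∣-least (+-mono-≤ (x≤∣x∣ x) (x≤∣x∣ y)) (begin
    - (x + y)        ≈⟨ solve 2 (λ x y → :- (x :+ y) := (:- x) :+ (:- y)) ≈-refl x y ⟩
    - x + - y        ≤⟨ +-mono-≤ (-x≤∣x∣ x) (-x≤∣x∣ y) ⟩
    ∣ x ∣ + ∣ y ∣    ∎)

  -- With a and b the two absolute values, (a - x)(b + y) + (a + x)(b - y) = 2(ab - xy), and all
  -- four factors on the left are nonnegative.
  x*y≤∣x∣*∣y∣ : ∀ x y → x * y ≤ ∣ x ∣ * ∣ y ∣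
  x*y≤∣x∣*∣y∣ x y = 0≤y-x⇒x≤y (halve (begin
    0#
      ≤⟨ *-nonneg (x≤y⇒0≤y-x (x≤∣x∣ x)) (x≤y⇒0≤y-x (-x≤∣x∣ y)) ⟩
    (∣ x ∣ - x) * (∣ y ∣ - - y)
      ≈⟨ +-identityʳ _ ⟨
    (∣ x ∣ - x) * (∣ y ∣ - - y) + 0#
      ≤⟨ +-mono-≤ ≤-refl (*-nonneg (x≤y⇒0≤y-x (-x≤∣x∣ x)) (x≤y⇒0≤y-x (x≤∣x∣ y))) ⟩
    (∣ x ∣ - x) * (∣ y ∣ - - y) + (∣ x ∣ - - x) * (∣ y ∣ - y)
      ≈⟨ solve 4 (λ x y a b →
           (a :- x) :* (b :- :- y) :+ (a :- :- x) :* (b :- y) :=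
           (a :* b :- x :* y) :+ (a :* b :- x :* y)) ≈-refl x y ∣ x ∣ ∣ y ∣ ⟩
    (∣ x ∣ * ∣ y ∣ - x * y) + (∣ x ∣ * ∣ y ∣ - x * y) ∎))

  ∣x*y∣≤∣x∣*∣y∣ : ∀ x y → ∣ x * y ∣ ≤ ∣ x ∣ * ∣ y ∣
  ∣x*y∣≤∣x∣*∣y∣ x y = ∣∣-least (x*y≤∣x∣*∣y∣ x y) (begin
    - (x * y)            ≈⟨ solve 2 (λ x y → :- (x :* y) := (:- x) :* y) ≈-refl x y ⟩
    - x * y              ≤⟨ x*y≤∣x∣*∣y∣ (- x) y ⟩
    ∣ - x ∣ * ∣ y ∣      ≤⟨ *-monoʳ-≤ (0≤∣x∣ y) (∣∣-least (-x≤∣x∣ x)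
                              (≤-trans (≤-reflexive (solve 1 (λ x → :- :- x := x) ≈-refl x)) (x≤∣x∣ x))) ⟩
    ∣ x ∣ * ∣ y ∣        ∎)

  ∣p-q∣≤u-l : ∀ {l u p q} → l ≤ p → p ≤ u → l ≤ q → q ≤ u → ∣ p - q ∣ ≤ u - l
  ∣p-q∣≤u-l {l} {u} {p} {q} l≤p p≤u l≤q q≤u =
    ∣∣-least (+-mono-≤ p≤u (neg-antimono-≤ l≤q)) (begin
      - (p - q)  ≈⟨ solve 2 (λ p q → :- (p :- q) := q :- p) ≈-refl p q ⟩
      q - p      ≤⟨ +-mono-≤ q≤u (neg-antimono-≤ l≤p) ⟩
      u - l      ∎)

  ^-nonneg : ∀ {x} n → 0# ≤ x → 0# ≤ x ^ n
  ^-nonneg zero    0≤x = ≤-trans (fromℚ-nonneg (ℚ.nonNegative⁻¹ 1ℚ)) (≤-reflexive fromℚ-1)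
  ^-nonneg (suc n) 0≤x = *-nonneg 0≤x (^-nonneg n 0≤x)

  ^-mono-≤ : ∀ {x y} n → 0# ≤ x → x ≤ y → x ^ n ≤ y ^ n
  ^-mono-≤ zero    0≤x x≤y = ≤-refl
  ^-mono-≤ {x} {y} (suc n) 0≤x x≤y = begin
    x * x ^ n   ≤⟨ *-monoʳ-≤ (^-nonneg n 0≤x) x≤y ⟩
    y * x ^ n   ≤⟨ *-monoˡ-≤ (≤-trans 0≤x x≤y) (^-mono-≤ n 0≤x x≤y) ⟩
    y * y ^ n   ∎

  nat : ℕ → A
  nat n = fromℚ (fromℕ n)

  nat-suc : ∀ n → nat (suc n) ≈ 1# + nat n
  nat-suc n = begin-equality
    fromℚ (fromℕ (suc n))         ≡⟨ ≡.cong fromℚ (fromℕ-suc n) ⟩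
    fromℚ (1ℚ ℚ.+ fromℕ n)        ≈⟨ fromℚ-+ 1ℚ (fromℕ n) ⟩
    fromℚ 1ℚ + fromℚ (fromℕ n)    ≈⟨ +-congʳ fromℚ-1 ⟩
    1# + nat n                    ∎

  recip : (d : ℕ) .{{_ : ℕ.NonZero d}} → A
  recip d = fromℚ (+ 1 ℚ./ d)

  recip*nat : ∀ d .{{_ : ℕ.NonZero d}} → recip d * nat d ≈ 1#
  recip*nat d = begin-equality
    recip d * nat d                    ≈⟨ fromℚ-* (+ 1 ℚ./ d) (fromℕ d) ⟨
    fromℚ ((+ 1 ℚ./ d) ℚ.* fromℕ d)    ≡⟨ ≡.cong fromℚ (recip*fromℕ d) ⟩
    fromℚ 1ℚ                           ≈⟨ fromℚ-1 ⟩
    1#                                 ∎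

  -- Integration of polynomials by telescoping Riemann sums.

  private
    -- A discrete product rule, the induction step of both bounds on the increment of a power.
    power-step : ∀ m a b → b * b ^ suc m - a * a ^ suc m ≈ b * (b ^ suc m - a ^ suc m) + a ^ suc m * (b - a)
    power-step m a b = solve 4 (λ a b p q →
      b :* q :- a :* p := b :* (q :- p) :+ p :* (b :- a)) ≈-refl a b (a ^ suc m) (b ^ suc m)

    linear : ∀ a b → nat 1 * 1# * (b - a) ≈ b * 1# - a * 1#
    linear a b = begin-equality
      nat 1 * 1# * (b - a)   ≈⟨ *-congʳ (*-congʳ fromℚ-1) ⟩
      1# * 1# * (b - a)      ≈⟨ solve 3 (λ a b e → e :* e :* (b :- a) := b :* e :* e :- a :* e :* e) ≈-refl a b 1# ⟩
      b * 1# * 1# - a * 1# * 1#  ≈⟨ +-cong (*-identityʳ (b * 1#)) (-‿cong (*-identityʳ (a * 1#))) ⟩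
      b * 1# - a * 1#        ∎

  -- In `power-step` the factor b of the first summand is lowered to a. The induction hypothesis
  -- then gives m + 1 copies of aᵐ⁺¹(b - a), and the second summand is one more.
  derivative-lower : ∀ m {a b} → 0# ≤ a → a ≤ b →
    nat (suc m) * a ^ m * (b - a) ≤ b ^ suc m - a ^ suc m
  derivative-lower zero    {a} {b} 0≤a a≤b = ≤-reflexive (linear a b)
  derivative-lower (suc m) {a} {b} 0≤a a≤b = begin
    nat (suc (suc m)) * (a * a ^ m) * (b - a)
      ≈⟨ *-congʳ (*-congʳ (nat-suc (suc m))) ⟩
    (1# + nat (suc m)) * (a * a ^ m) * (b - a)
      ≈⟨ *-congʳ (distribʳ (a * a ^ m) 1# (nat (suc m))) ⟩
    (1# * (a * a ^ m) + nat (suc m) * (a * a ^ m)) * (b - a)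
      ≈⟨ *-congʳ (+-congʳ (*-identityˡ (a * a ^ m))) ⟩
    ((a * a ^ m) + nat (suc m) * (a * a ^ m)) * (b - a)
      ≈⟨ solve 4 (λ a b p n → (a :* p :+ n :* (a :* p)) :* (b :- a) :=
           a :* (n :* p :* (b :- a)) :+ (a :* p) :* (b :- a)) ≈-refl a b (a ^ m) (nat (suc m)) ⟩
    a * (nat (suc m) * a ^ m * (b - a)) + (a * a ^ m) * (b - a)
      ≤⟨ +-mono-≤ (*-monoˡ-≤ 0≤a (derivative-lower m 0≤a a≤b)) ≤-refl ⟩
    a * (b ^ suc m - a ^ suc m) + (a * a ^ m) * (b - a)
      ≤⟨ +-mono-≤ (*-monoʳ-≤ (x≤y⇒0≤y-x (^-mono-≤ (suc m) 0≤a a≤b)) a≤b) ≤-refl ⟩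
    b * (b ^ suc m - a ^ suc m) + a ^ suc m * (b - a)
      ≈⟨ power-step m a b ⟨
    b ^ suc (suc m) - a ^ suc (suc m) ∎

  -- Dual to the lower bound: b stays, and the factor aᵐ⁺¹ of the second summand is raised to bᵐ⁺¹.
  derivative-upper : ∀ m {a b} → 0# ≤ a → a ≤ b →
    b ^ suc m - a ^ suc m ≤ nat (suc m) * b ^ m * (b - a)
  derivative-upper zero    {a} {b} 0≤a a≤b = ≤-reflexive (≈-sym (linear a b))
  derivative-upper (suc m) {a} {b} 0≤a a≤b = begin
    b ^ suc (suc m) - a ^ suc (suc m)
      ≈⟨ power-step m a b ⟩
    b * (b ^ suc m - a ^ suc m) + a ^ suc m * (b - a)
      ≤⟨ +-mono-≤ (*-monoˡ-≤ (≤-trans 0≤a a≤b) (derivative-upper m 0≤a a≤b))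
                  (*-monoʳ-≤ (x≤y⇒0≤y-x a≤b) (^-mono-≤ (suc m) 0≤a a≤b)) ⟩
    b * (nat (suc m) * b ^ m * (b - a)) + (b * b ^ m) * (b - a)
      ≈⟨ solve 4 (λ a b p n → b :* (n :* p :* (b :- a)) :+ (b :* p) :* (b :- a) :=
           (b :* p :+ n :* (b :* p)) :* (b :- a)) ≈-refl a b (b ^ m) (nat (suc m)) ⟩
    ((b * b ^ m) + nat (suc m) * (b * b ^ m)) * (b - a)
      ≈⟨ *-congʳ (+-congʳ (*-identityˡ (b * b ^ m))) ⟨
    (1# * (b * b ^ m) + nat (suc m) * (b * b ^ m)) * (b - a)
      ≈⟨ *-congʳ (distribʳ (b * b ^ m) 1# (nat (suc m))) ⟨
    (1# + nat (suc m)) * (b * b ^ m) * (b - a)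
      ≈⟨ *-congʳ (*-congʳ (nat-suc (suc m))) ⟨
    nat (suc (suc m)) * (b * b ^ m) * (b - a) ∎

  -- F is an antiderivative of f on [0,∞), with V controlling the oscillation of f.
  record Antiderivative (f F V : A → A) : Set where
    field
      F-cong : ∀ {x y} → x ≈ y → F x ≈ F y
      V-cong : ∀ {x y} → x ≈ y → V x ≈ V y
      V-mono : ∀ {a b} → 0# ≤ a → a ≤ b → V a ≤ V b
      error  : ∀ {a τ b} → 0# ≤ a → a ≤ τ → τ ≤ b →
               ∣ f τ * (b - a) - (F b - F a) ∣ ≤ (V b - V a) * (b - a)

  open Antiderivative

  -- A power is increasing on [0,∞) and so serves as its own `V`: the term at τ and the increment of
  -- `F` both lie between aᵐ(b - a) and bᵐ(b - a).
  monomial : ∀ m → Antiderivative (_^ m) (λ t → recip (suc m) * t ^ suc m) (_^ m)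
  monomial m .F-cong e = *-congˡ (^-congˡ (suc m) e)
  monomial m .V-cong e = ^-congˡ m e
  monomial m .V-mono = ^-mono-≤ m
  monomial m .error {a} {τ} {b} 0≤a a≤τ τ≤b = begin
    ∣ τ ^ m * (b - a) - (r * b ^ suc m - r * a ^ suc m) ∣
      ≤⟨ ∣p-q∣≤u-l (*-monoʳ-≤ 0≤w (^-mono-≤ m 0≤a a≤τ)) (*-monoʳ-≤ 0≤w (^-mono-≤ m (≤-trans 0≤a a≤τ) τ≤b))
           lower upper ⟩
    b ^ m * (b - a) - a ^ m * (b - a)
      ≈⟨ solve 3 (λ p q w → q :* w :- p :* w := (q :- p) :* w) ≈-refl (a ^ m) (b ^ m) (b - a) ⟩
    (b ^ m - a ^ m) * (b - a) ∎
    where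
    r : A
    r = recip (suc m)

    a≤b : a ≤ b
    a≤b = ≤-trans a≤τ τ≤b

    0≤w : 0# ≤ b - a
    0≤w = x≤y⇒0≤y-x a≤b

    0≤r : 0# ≤ r
    0≤r = fromℚ-nonneg (0≤recip (suc m))

    normalise : ∀ p → p * (b - a) ≈ r * (nat (suc m) * p * (b - a))
    normalise p = begin-equality
      p * (b - a)                          ≈⟨ *-identityˡ _ ⟨
      1# * (p * (b - a))                   ≈⟨ *-congʳ (recip*nat (suc m)) ⟨
      r * nat (suc m) * (p * (b - a))
        ≈⟨ solve 4 (λ r n p w → r :* n :* (p :* w) := r :* (n :* p :* w)) ≈-refl r (nat (suc m)) p (b - a) ⟩
      r * (nat (suc m) * p * (b - a))      ∎

    spread : r * b ^ suc m - r * a ^ suc m ≈ r * (b ^ suc m - a ^ suc m)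
    spread = solve 3 (λ r p q → r :* q :- r :* p := r :* (q :- p)) ≈-refl r (a ^ suc m) (b ^ suc m)

    lower : a ^ m * (b - a) ≤ r * b ^ suc m - r * a ^ suc m
    lower = begin
      a ^ m * (b - a)                       ≈⟨ normalise (a ^ m) ⟩
      r * (nat (suc m) * a ^ m * (b - a))   ≤⟨ *-monoˡ-≤ 0≤r (derivative-lower m 0≤a a≤b) ⟩
      r * (b ^ suc m - a ^ suc m)           ≈⟨ spread ⟨
      r * b ^ suc m - r * a ^ suc m         ∎

    upper : r * b ^ suc m - r * a ^ suc m ≤ b ^ m * (b - a)
    upper = begin
      r * b ^ suc m - r * a ^ suc m         ≈⟨ spread ⟩
      r * (b ^ suc m - a ^ suc m)           ≤⟨ *-monoˡ-≤ 0≤r (derivative-upper m 0≤a a≤b) ⟩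
      r * (nat (suc m) * b ^ m * (b - a))   ≈⟨ normalise (b ^ m) ⟨
      b ^ m * (b - a)                       ∎

  -- `∣ c ∣` instead of `c` keeps the control function increasing when `c` is negative.
  scale : ∀ {f F V} c → Antiderivative f F V →
    Antiderivative (λ t → c * f t) (λ t → c * F t) (λ t → ∣ c ∣ * V t)
  scale c d .F-cong e = *-congˡ (F-cong d e)
  scale c d .V-cong e = *-congˡ (V-cong d e)
  scale c d .V-mono 0≤a a≤b = *-monoˡ-≤ (0≤∣x∣ c) (V-mono d 0≤a a≤b)
  scale {f} {F} {V} c d .error {a} {τ} {b} 0≤a a≤τ τ≤b = begin
    ∣ c * f τ * (b - a) - (c * F b - c * F a) ∣
      ≈⟨ ∣∣-cong (solve 5 (λ c p w q r → c :* p :* w :- (c :* q :- c :* r) := c :* (p :* w :- (q :- r)))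
           ≈-refl c (f τ) (b - a) (F b) (F a)) ⟩
    ∣ c * (f τ * (b - a) - (F b - F a)) ∣
      ≤⟨ ∣x*y∣≤∣x∣*∣y∣ c _ ⟩
    ∣ c ∣ * ∣ f τ * (b - a) - (F b - F a) ∣
      ≤⟨ *-monoˡ-≤ (0≤∣x∣ c) (error d 0≤a a≤τ τ≤b) ⟩
    ∣ c ∣ * ((V b - V a) * (b - a))
      ≈⟨ solve 4 (λ c w q r → c :* ((q :- r) :* w) := (c :* q :- c :* r) :* w)
           ≈-refl ∣ c ∣ (b - a) (V b) (V a) ⟩
    (∣ c ∣ * V b - ∣ c ∣ * V a) * (b - a) ∎

  zero-antiderivative : Antiderivative (λ _ → 0#) (λ _ → 0#) (λ _ → 0#)
  zero-antiderivative .F-cong _ = ≈-refl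
  zero-antiderivative .V-cong _ = ≈-refl
  zero-antiderivative .V-mono _ _ = ≤-refl
  zero-antiderivative .error {a} {τ} {b} _ _ _ = ≤-trans
    (≤-reflexive (∣∣-cong collapse)) (∣∣-least (≤-reflexive (≈-sym collapse′)) (≤-reflexive (≈-trans -0≈0 (≈-sym collapse′))))
    where
    -0≈0 : - 0# ≈ 0#
    -0≈0 = ≈-trans (≈-sym (+-identityˡ (- 0#))) (-‿inverseʳ 0#)

    collapse′ : (0# - 0#) * (b - a) ≈ 0#
    collapse′ = ≈-trans (*-congʳ (-‿inverseʳ 0#)) (zeroˡ (b - a))

    collapse : 0# * (b - a) - (0# - 0#) ≈ 0#
    collapse = ≈-trans (+-cong (zeroˡ (b - a)) (-‿cong (-‿inverseʳ 0#))) (-‿inverseʳ 0#)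

  plus : ∀ {f F V g G W} → Antiderivative f F V → Antiderivative g G W →
    Antiderivative (λ t → f t + g t) (λ t → F t + G t) (λ t → V t + W t)
  plus d e .F-cong h = +-cong (F-cong d h) (F-cong e h)
  plus d e .V-cong h = +-cong (V-cong d h) (V-cong e h)
  plus d e .V-mono 0≤a a≤b = +-mono-≤ (V-mono d 0≤a a≤b) (V-mono e 0≤a a≤b)
  plus {f} {F} {V} {g} {G} {W} d e .error {a} {τ} {b} 0≤a a≤τ τ≤b = begin
    ∣ (f τ + g τ) * (b - a) - ((F b + G b) - (F a + G a)) ∣
      ≈⟨ ∣∣-cong (solve 7 (λ w p q r s t u →
           (p :+ q) :* w :- ((r :+ s) :- (t :+ u)) := (p :* w :- (r :- t)) :+ (q :* w :- (s :- u)))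
           ≈-refl (b - a) (f τ) (g τ) (F b) (G b) (F a) (G a)) ⟩
    ∣ (f τ * (b - a) - (F b - F a)) + (g τ * (b - a) - (G b - G a)) ∣
      ≤⟨ ∣x+y∣≤∣x∣+∣y∣ _ _ ⟩
    ∣ f τ * (b - a) - (F b - F a) ∣ + ∣ g τ * (b - a) - (G b - G a) ∣
      ≤⟨ +-mono-≤ (error d 0≤a a≤τ τ≤b) (error e 0≤a a≤τ τ≤b) ⟩
    (V b - V a) * (b - a) + (W b - W a) * (b - a)
      ≈⟨ solve 5 (λ w r s t u → (r :- t) :* w :+ (s :- u) :* w := ((r :+ s) :- (t :+ u)) :* w)
           ≈-refl (b - a) (V b) (W b) (V a) (W a) ⟩
    ((V b + W b) - (V a + W a)) * (b - a) ∎

  sum-antiderivative : ∀ {n} {f F V : Fin n → A → A} → (∀ i → Antiderivative (f i) (F i) (V i)) →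
    Antiderivative (λ t → sum λ i → f i t) (λ t → sum λ i → F i t) (λ t → sum λ i → V i t)
  sum-antiderivative {zero}  d = zero-antiderivative
  sum-antiderivative {suc n} d = plus (d fzero) (sum-antiderivative (d ∘ fsuc))

  sum-mono-≤ : ∀ {n} {u v : Fin n → A} → (∀ i → u i ≤ v i) → sum u ≤ sum v
  sum-mono-≤ {zero}  h = ≤-refl
  sum-mono-≤ {suc n} h = +-mono-≤ (h fzero) (sum-mono-≤ (h ∘ fsuc))

  ∣sum∣≤sum∣∣ : ∀ {n} (u : Fin n → A) → ∣ sum u ∣ ≤ sum (λ i → ∣ u i ∣)
  ∣sum∣≤sum∣∣ {zero}  u = ∣∣-least ≤-refl (≤-reflexive (begin-equality
    - 0#        ≈⟨ +-identityˡ (- 0#) ⟨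
    0# - 0#     ≈⟨ -‿inverseʳ 0# ⟩
    0#          ∎))
  ∣sum∣≤sum∣∣ {suc n} u = ≤-trans (∣x+y∣≤∣x∣+∣y∣ _ _) (+-mono-≤ ≤-refl (∣sum∣≤sum∣∣ (u ∘ fsuc)))

  sum-sub : ∀ {n} (u v : Fin n → A) → sum (λ i → u i - v i) ≈ sum u - sum v
  sum-sub {zero}  u v = ≈-sym (-‿inverseʳ 0#)
  sum-sub {suc n} u v = begin-equality
    (u fzero - v fzero) + sum (λ i → u (fsuc i) - v (fsuc i))
      ≈⟨ +-congˡ (sum-sub (u ∘ fsuc) (v ∘ fsuc)) ⟩
    (u fzero - v fzero) + (sum (u ∘ fsuc) - sum (v ∘ fsuc))
      ≈⟨ solve 4 (λ a b s t → (a :- b) :+ (s :- t) := (a :+ s) :- (b :+ t))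
           ≈-refl (u fzero) (v fzero) (sum (u ∘ fsuc)) (sum (v ∘ fsuc)) ⟩
    sum u - sum v ∎

  telescope : ∀ {r} (g : Fin (suc r) → A) →
    sum (λ i → g (fsuc i) - g (inject₁ i)) ≈ g (flast r) - g fzero
  telescope {zero}  g = ≈-sym (-‿inverseʳ (g fzero))
  telescope {suc r} g = begin-equality
    (g (fsuc fzero) - g fzero) + sum (λ i → g (fsuc (fsuc i)) - g (fsuc (inject₁ i)))
      ≈⟨ +-congˡ (telescope (g ∘ fsuc)) ⟩
    (g (fsuc fzero) - g fzero) + (g (flast (suc r)) - g (fsuc fzero))
      ≈⟨ solve 3 (λ a b c → (b :- a) :+ (c :- b) := c :- a)
           ≈-refl (g fzero) (g (fsuc fzero)) (g (flast (suc r))) ⟩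
    g (flast (suc r)) - g fzero ∎

  -- Antiderivatives are controlled on [0,∞) only; this places all points of a partition there.
  nonneg-from-first : ∀ {r} (g : Fin (suc r) → A) → 0# ≤ g fzero →
    (∀ i → g (inject₁ i) ≤ g (fsuc i)) → ∀ i → 0# ≤ g i
  nonneg-from-first g 0≤g mono fzero = 0≤g
  nonneg-from-first {suc r} g 0≤g mono (fsuc i) =
    nonneg-from-first (g ∘ fsuc) (≤-trans 0≤g (mono fzero)) (mono ∘ fsuc) i

  record IsTaggedPartition {r} (x : Fin (suc r) → A) (τ w : Fin r → A) : Set where
    field
      first : x fzero ≈ 0#
      last  : x (flast r) ≈ 1#
      lower : ∀ i → x (inject₁ i) ≤ τ i
      upper : ∀ i → τ i ≤ x (fsuc i)
      width : ∀ i → w i ≈ x (fsuc i) - x (inject₁ i)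

  -- An interval contributes at most the increase of `V` times its width. With the widths replaced
  -- by η, the increases telescope. The congruences of `F` and `V` enter because the end points are
  -- 0 and 1 only up to equality in the algebra.
  riemann-sum-error : ∀ {f F V} → Antiderivative f F V → ∀ {η} → 0# ≤ η →
    ∀ {r} {x : Fin (suc r) → A} {τ w} → IsTaggedPartition x τ w → (∀ i → w i ≤ η) →
    ∣ sum (λ i → f (τ i) * w i) - (F 1# - F 0#) ∣ ≤ (V 1# - V 0#) * η
  riemann-sum-error {f} {F} {V} d {η} 0≤η {r} {x} {τ} {w} p w≤η = begin
    ∣ sum (λ i → f (τ i) * w i) - (F 1# - F 0#) ∣
      ≈⟨ ∣∣-cong (+-cong (sum-cong-≋ λ i → *-congˡ (width i))
           (-‿cong (+-cong (F-cong d (≈-sym last)) (-‿cong (F-cong d (≈-sym first)))))) ⟩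
    ∣ sum (λ i → f (τ i) * (x (fsuc i) - x (inject₁ i))) - (F (x (flast r)) - F (x fzero)) ∣
      ≈⟨ ∣∣-cong (+-congˡ (-‿cong (telescope (F ∘ x)))) ⟨
    ∣ sum (λ i → f (τ i) * (x (fsuc i) - x (inject₁ i))) - sum (λ i → F (x (fsuc i)) - F (x (inject₁ i))) ∣
      ≈⟨ ∣∣-cong (sum-sub (λ i → f (τ i) * (x (fsuc i) - x (inject₁ i))) _) ⟨
    ∣ sum (λ i → f (τ i) * (x (fsuc i) - x (inject₁ i)) - (F (x (fsuc i)) - F (x (inject₁ i)))) ∣
      ≤⟨ ∣sum∣≤sum∣∣ (λ i → f (τ i) * (x (fsuc i) - x (inject₁ i)) - (F (x (fsuc i)) - F (x (inject₁ i)))) ⟩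
    sum (λ i → ∣ f (τ i) * (x (fsuc i) - x (inject₁ i)) - (F (x (fsuc i)) - F (x (inject₁ i))) ∣)
      ≤⟨ sum-mono-≤ (λ i → error d (0≤x (inject₁ i)) (lower i) (upper i)) ⟩
    sum (λ i → (V (x (fsuc i)) - V (x (inject₁ i))) * (x (fsuc i) - x (inject₁ i)))
      ≤⟨ sum-mono-≤ (λ i → *-monoˡ-≤ (x≤y⇒0≤y-x (V-mono d (0≤x (inject₁ i)) (x-mono i)))
           (≤-trans (≤-reflexive (≈-sym (width i))) (w≤η i))) ⟩
    sum (λ i → (V (x (fsuc i)) - V (x (inject₁ i))) * η)
      ≈⟨ *-distribʳ-sum η (λ i → V (x (fsuc i)) - V (x (inject₁ i))) ⟨
    sum (λ i → V (x (fsuc i)) - V (x (inject₁ i))) * η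
      ≈⟨ *-congʳ (telescope (V ∘ x)) ⟩
    (V (x (flast r)) - V (x fzero)) * η
      ≈⟨ *-congʳ (+-cong (V-cong d last) (-‿cong (V-cong d first))) ⟩
    (V 1# - V 0#) * η ∎
    where
    open IsTaggedPartition p
    x-mono : ∀ i → x (inject₁ i) ≤ x (fsuc i)
    x-mono i = ≤-trans (lower i) (upper i)

    0≤x : ∀ i → 0# ≤ x i
    0≤x = nonneg-from-first x (≤-reflexive (≈-sym first)) x-mono

  integral : ∀ {f F V} → Antiderivative f F V → ∀ ε → 0ℚ ℚ.< ε → ∃ λ δ → 0ℚ ℚ.< δ ×
    (∀ {r} {x : Fin (suc r) → A} {τ w} → IsTaggedPartition x τ w → (∀ i → w i ≤ fromℚ δ) →
     ∣ sum (λ i → f (τ i) * w i) - (F 1# - F 0#) ∣ ≤ fromℚ ε)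
  integral {f} {F} {V} d ε 0<ε =
    -- `B` is a rational bound for the total increase of `V`, whence the mesh δ = ε/B.
    let B , 0<B , V≤B = bounded (V 1# - V 0#)
        δ , 0<δ , Bδ≡ε = divide 0<B 0<ε
        0≤δ = fromℚ-nonneg (ℚ.<⇒≤ 0<δ)
    in δ , 0<δ , λ {r} {x} {τ} {w} p w≤δ → begin
      ∣ sum (λ i → f (τ i) * w i) - (F 1# - F 0#) ∣  ≤⟨ riemann-sum-error d 0≤δ p w≤δ ⟩
      (V 1# - V 0#) * fromℚ δ                        ≤⟨ *-monoʳ-≤ 0≤δ V≤B ⟩
      fromℚ B * fromℚ δ                              ≈⟨ fromℚ-* B δ ⟨
      fromℚ (B ℚ.* δ)                                ≡⟨ ≡.cong fromℚ Bδ≡ε ⟩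
      fromℚ ε                                        ∎

  -- Uniform partitions and uniqueness of limits.

  module Uniform (d : ℕ) where
    node : ℕ → A
    node j = nat j * recip (suc d)

    point : Fin (suc (suc d)) → A
    point i = node (toℕ i)

    tag : Fin (suc d) → A
    tag i = point (inject₁ i)

    node-suc : ∀ j → node (suc j) ≈ node j + recip (suc d)
    node-suc j = begin-equality
      nat (suc j) * recip (suc d)        ≈⟨ *-congʳ (nat-suc j) ⟩
      (1# + nat j) * recip (suc d)       ≈⟨ distribʳ (recip (suc d)) 1# (nat j) ⟩
      1# * recip (suc d) + node j        ≈⟨ +-congʳ (*-identityˡ (recip (suc d))) ⟩
      recip (suc d) + node j             ≈⟨ +-comm (recip (suc d)) (node j) ⟩
      node j + recip (suc d)             ∎

    point-suc : ∀ i → point (fsuc i) ≈ tag i + recip (suc d)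
    point-suc i = ≈-trans (node-suc (toℕ i))
      (≈-reflexive (≡.cong (λ j → node j + recip (suc d)) (≡.sym (toℕ-inject₁ i))))

    point-first : point fzero ≈ 0#
    point-first = ≈-trans (*-congʳ fromℚ-0) (zeroˡ (recip (suc d)))

    point-last : point (flast (suc d)) ≈ 1#
    point-last = begin-equality
      node (toℕ (flast (suc d)))    ≡⟨ ≡.cong node (toℕ-fromℕ (suc d)) ⟩
      nat (suc d) * recip (suc d)   ≈⟨ *-comm (nat (suc d)) (recip (suc d)) ⟩
      recip (suc d) * nat (suc d)   ≈⟨ recip*nat (suc d) ⟩
      1#                            ∎

    tag≤point : ∀ i → tag i ≤ point (fsuc i)
    tag≤point i = begin
      tag i                    ≈⟨ +-identityʳ (tag i) ⟨
      tag i + 0#               ≤⟨ +-mono-≤ ≤-refl (fromℚ-nonneg (0≤recip (suc d))) ⟩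
      tag i + recip (suc d)    ≈⟨ point-suc i ⟨
      point (fsuc i)           ∎

    width≈recip : ∀ i → point (fsuc i) - tag i ≈ recip (suc d)
    width≈recip i = begin-equality
      point (fsuc i) - tag i          ≈⟨ +-congʳ (point-suc i) ⟩
      tag i + recip (suc d) - tag i   ≈⟨ solve 2 (λ t r → t :+ r :- t := r) ≈-refl (tag i) (recip (suc d)) ⟩
      recip (suc d)                   ∎

    0≤point : ∀ i → 0# ≤ point i
    0≤point = nonneg-from-first point (≤-reflexive (≈-sym point-first)) tag≤point

    nat-mono-≤ : ∀ {m n} → m ℕ.≤ n → nat m ≤ nat n
    nat-mono-≤ {zero} {zero} ℕ.z≤n = ≤-refl
    nat-mono-≤ {m} {suc n} h with ℕ.m≤n⇒m<n∨m≡n h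
    ... | inj₂ ≡.refl = ≤-refl
    ... | inj₁ (ℕ.s≤s m≤n) = begin
      nat m           ≤⟨ nat-mono-≤ {m} {n} m≤n ⟩
      nat n           ≈⟨ +-identityˡ (nat n) ⟨
      0# + nat n      ≤⟨ +-mono-≤ (fromℚ-nonneg (ℚ.nonNegative⁻¹ 1ℚ)) ≤-refl ⟩
      fromℚ 1ℚ + nat n ≈⟨ +-congʳ fromℚ-1 ⟩
      1# + nat n      ≈⟨ nat-suc n ⟨
      nat (suc n)     ∎

    -- The integrands that uniqueness compares agree on [0,1] only, so the tags must not leave it.
    tag≤1 : ∀ i → tag i ≤ 1#
    tag≤1 i = begin
      tag i                         ≤⟨ *-monoʳ-≤ (fromℚ-nonneg (0≤recip (suc d))) (nat-mono-≤ {toℕ (inject₁ i)} {suc d} (ℕ.s≤s⁻¹ (toℕ<n (inject₁ i)))) ⟩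
      nat (suc d) * recip (suc d)   ≈⟨ *-comm (nat (suc d)) (recip (suc d)) ⟩
      recip (suc d) * nat (suc d)   ≈⟨ recip*nat (suc d) ⟩
      1#                            ∎

  -- Through a common `S` within ε/2 of both, each number exceeds the other by at most ε, and
  -- `≤-closed` removes the ε.
  close⇒≈ : ∀ {I J} → (∀ ε → 0ℚ ℚ.< ε → ∃ λ S → ∣ S - I ∣ ≤ fromℚ ε × ∣ S - J ∣ ≤ fromℚ ε) → I ≈ J
  close⇒≈ h = ≤-antisym (half h) (half λ ε 0<ε → let S , p , q = h ε 0<ε in S , q , p)
    where
    half : ∀ {I J} → (∀ ε → 0ℚ ℚ.< ε → ∃ λ S → ∣ S - I ∣ ≤ fromℚ ε × ∣ S - J ∣ ≤ fromℚ ε) → I ≤ J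
    half {I} {J} h = ≤-closed λ ε 0<ε →
      let η , 0<η , 2η≡ε = divide (ℚ.positive⁻¹ (1ℚ ℚ.+ 1ℚ)) 0<ε
          S , p , q = h η 0<η
      in begin
        I                           ≈⟨ solve 3 (λ I J S → I := J :+ ((S :- J) :+ (:- (S :- I)))) ≈-refl I J S ⟩
        J + ((S - J) + - (S - I))   ≤⟨ +-mono-≤ ≤-refl (+-mono-≤ (≤-trans (x≤∣x∣ _) q) (≤-trans (-x≤∣x∣ _) p)) ⟩
        J + (fromℚ η + fromℚ η)     ≈⟨ +-congˡ (solve 1 (λ η → η :+ η := con (1ℚ ℚ.+ 1ℚ) :* η) ≈-refl (fromℚ η)) ⟩
        J + fromℚ (1ℚ ℚ.+ 1ℚ) * fromℚ η  ≈⟨ +-congˡ (fromℚ-* (1ℚ ℚ.+ 1ℚ) η) ⟨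
        J + fromℚ ((1ℚ ℚ.+ 1ℚ) ℚ.* η)    ≡⟨ ≡.cong (λ q → J + fromℚ q) 2η≡ε ⟩
        J + fromℚ ε                 ∎

-- Generalised Stirling numbers and the expansion of the rising factorial.

module _ (M : Monoid 0ℓ 0ℓ) where
  open Monoid M
  open MonoidSum M using (sum)

  -- Sums and products are built from the front, while the recursions in n split off the last term.
  -- Stated for a monoid to serve sums and products alike.
  sum-last : ∀ n (a : ℕ → Carrier) → sum {suc n} (a ∘ toℕ) ≈ sum {n} (a ∘ toℕ) ∙ a n
  sum-last zero    a = trans (identityʳ (a 0)) (sym (identityˡ (a 0)))
  sum-last (suc n) a = trans (∙-congˡ (sum-last n (a ∘ suc))) (sym (assoc (a 0) _ (a (suc n))))

stirling₁-vanish : ∀ {n j} → n ℕ.< j → stirling₁ n j ≡ 0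
stirling₁-vanish {zero}  {suc j} _         = ≡.refl
stirling₁-vanish {suc n} {suc j} (ℕ.s≤s h) = begin
  n ℕ.* stirling₁ n (suc j) ℕ.+ stirling₁ n j
    ≡⟨ ≡.cong₂ (λ p q → n ℕ.* p ℕ.+ q) (stirling₁-vanish (ℕ.m≤n⇒m≤1+n h)) (stirling₁-vanish h) ⟩
  n ℕ.* 0 ℕ.+ 0
    ≡⟨ ≡.cong (ℕ._+ 0) (ℕ.*-zeroʳ n) ⟩
  0 ∎
  where open ≡.≡-Reasoning

-- This extends the Stirling recurrence to column 0, where the next number is 0 and the column to
-- the left is missing.
n*stirling₁[n,0]≡0 : ∀ n → n ℕ.* stirling₁ n 0 ≡ 0
n*stirling₁[n,0]≡0 zero    = ≡.refl
n*stirling₁[n,0]≡0 (suc n) = ℕ.*-zeroʳ n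

-- The coefficient of x^i in the generalised Stirling number.
coefficient : ℕ → ℕ → ℕ → ℕ
coefficient n m i = ((i ℕ.+ m) C m) ℕ.* stirling₁ n (i ℕ.+ m)

-- The Stirling recurrence, followed by Pascal's rule for the binomial in front of
-- `stirling₁ n (i ℕ.+ m)`. The last summand is the coefficient of xⁱ in x times the generalised
-- number at `n` and `suc m`.
coefficient-suc : ∀ n m i → coefficient (suc n) (suc m) i ≡
  (n ℕ.* coefficient n (suc m) i ℕ.+ coefficient n m i) ℕ.+ ((i ℕ.+ m) C suc m) ℕ.* stirling₁ n (i ℕ.+ m)
coefficient-suc n m i rewrite ℕ.+-suc i m = begin
  c ℕ.* (n ℕ.* s ℕ.+ t)
    ≡⟨ solve 4 (λ c n s t → c :* (n :* s :+ t) := n :* (c :* s) :+ c :* t) ≡.refl c n s t ⟩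
  n ℕ.* (c ℕ.* s) ℕ.+ c ℕ.* t
    ≡⟨ ≡.cong (λ b → n ℕ.* (c ℕ.* s) ℕ.+ b ℕ.* t) (nCk+nC[k+1]≡[n+1]C[k+1] (i ℕ.+ m) m) ⟨
  n ℕ.* (c ℕ.* s) ℕ.+ (a ℕ.+ b) ℕ.* t
    ≡⟨ solve 4 (λ u a b t → u :+ (a :+ b) :* t := (u :+ a :* t) :+ b :* t) ≡.refl (n ℕ.* (c ℕ.* s)) a b t ⟩
  (n ℕ.* (c ℕ.* s) ℕ.+ a ℕ.* t) ℕ.+ b ℕ.* t ∎
  where
  open ≡.≡-Reasoning
  open ℕ-Solver
  a b c s t : ℕ
  a = (i ℕ.+ m) C m
  b = (i ℕ.+ m) C suc m
  c = suc (i ℕ.+ m) C suc m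
  s = stirling₁ n (suc (i ℕ.+ m))
  t = stirling₁ n (i ℕ.+ m)

coefficient-zero-suc : ∀ n i → coefficient (suc n) 0 (suc i) ≡
  n ℕ.* coefficient n 0 (suc i) ℕ.+ coefficient n 0 i
coefficient-zero-suc n i =
  solve 3 (λ n s t → con 1 :* (n :* s :+ t) := n :* (con 1 :* s) :+ con 1 :* t) ≡.refl
    n (stirling₁ n (suc (i ℕ.+ 0))) (stirling₁ n (i ℕ.+ 0))
  where open ℕ-Solver

coefficient-vanish : ∀ n m i → n ℕ.< i ℕ.+ m → coefficient n m i ≡ 0
coefficient-vanish n m i h = ≡.trans (≡.cong (((i ℕ.+ m) C m) ℕ.*_) (stirling₁-vanish h)) (ℕ.*-zeroʳ ((i ℕ.+ m) C m))

module Stirling (R : CommutativeRing 0ℓ 0ℓ) (nat : ℕ → CommutativeRing.Carrier R)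
    (nat-zero : CommutativeRing._≈_ R (nat 0) (CommutativeRing.0# R))
    (nat-suc : ∀ n → CommutativeRing._≈_ R (nat (suc n)) (CommutativeRing._+_ R (CommutativeRing.1# R) (nat n)))
    where

  open CommutativeRing R
  open Exp semiring using (_^_)
  open SemiringSum semiring using (sum; sum-cong-≋; ∑-distrib-+; *-distribˡ-sum)
  open MonoidSum *-monoid using () renaming (sum to product)
  open import Relation.Binary.Reasoning.Setoid setoid

  nat-+ : ∀ m n → nat (m ℕ.+ n) ≈ nat m + nat n
  nat-+ zero    n = trans (sym (+-identityˡ (nat n))) (+-congʳ (sym nat-zero))
  nat-+ (suc m) n = begin
    nat (suc (m ℕ.+ n))      ≈⟨ nat-suc (m ℕ.+ n) ⟩
    1# + nat (m ℕ.+ n)       ≈⟨ +-congˡ (nat-+ m n) ⟩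
    1# + (nat m + nat n)     ≈⟨ +-assoc 1# (nat m) (nat n) ⟨
    1# + nat m + nat n       ≈⟨ +-congʳ (nat-suc m) ⟨
    nat (suc m) + nat n      ∎

  nat-* : ∀ m n → nat (m ℕ.* n) ≈ nat m * nat n
  nat-* zero    n = trans nat-zero (trans (sym (zeroˡ (nat n))) (*-congʳ (sym nat-zero)))
  nat-* (suc m) n = begin
    nat (n ℕ.+ m ℕ.* n)             ≈⟨ nat-+ n (m ℕ.* n) ⟩
    nat n + nat (m ℕ.* n)           ≈⟨ +-cong (sym (*-identityˡ (nat n))) (nat-* m n) ⟩
    1# * nat n + nat m * nat n      ≈⟨ distribʳ (nat n) 1# (nat m) ⟨
    (1# + nat m) * nat n            ≈⟨ *-congʳ (nat-suc m) ⟨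
    nat (suc m) * nat n             ∎

  nat-vanish : ∀ {n} → n ≡ 0 → ∀ z → nat n * z ≈ 0#
  nat-vanish ≡.refl z = trans (*-congʳ nat-zero) (zeroˡ z)

  ∑ : ℕ → (ℕ → Carrier) → Carrier
  ∑ n a = sum {n} (a ∘ toℕ)

  ∑-cong : ∀ n {a b : ℕ → Carrier} → (∀ i → a i ≈ b i) → ∑ n a ≈ ∑ n b
  ∑-cong n h = sum-cong-≋ {n} (h ∘ toℕ)

  ∑-+ : ∀ n (a b : ℕ → Carrier) → ∑ n (λ i → a i + b i) ≈ ∑ n a + ∑ n b
  ∑-+ n a b = ∑-distrib-+ {n} (a ∘ toℕ) (b ∘ toℕ)

  ∑-* : ∀ n z (a : ℕ → Carrier) → ∑ n (λ i → z * a i) ≈ z * ∑ n a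
  ∑-* n z a = sym (*-distribˡ-sum {n} z (a ∘ toℕ))

  ∑-last : ∀ n (a : ℕ → Carrier) → ∑ (suc n) a ≈ ∑ n a + a n
  ∑-last = sum-last +-monoid

  -- The generalised Stirling number, summed up to an arbitrary bound N.
  G : ℕ → ℕ → ℕ → Carrier → Carrier
  G N n m x = ∑ N λ i → nat (coefficient n m i) * x ^ i

  -- Terms with i + m > n vanish. All columns can therefore be summed to one common bound, and the
  -- triangular double sum becomes a rectangular one.
  G-stable : ∀ d N n m x → n ℕ.< N ℕ.+ m → G (d ℕ.+ N) n m x ≈ G N n m x
  G-stable zero    N n m x h = refl
  G-stable (suc d) N n m x h = begin
    G (suc d ℕ.+ N) n m x
      ≈⟨ ∑-last (d ℕ.+ N) (λ i → nat (coefficient n m i) * x ^ i) ⟩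
    G (d ℕ.+ N) n m x + nat (coefficient n m (d ℕ.+ N)) * x ^ (d ℕ.+ N)
      ≈⟨ +-cong (G-stable d N n m x h)
           (nat-vanish (coefficient-vanish n m (d ℕ.+ N)
             (ℕ.≤-trans h (ℕ.+-monoˡ-≤ m (ℕ.m≤n+m N d)))) (x ^ (d ℕ.+ N))) ⟩
    G N n m x + 0#
      ≈⟨ +-identityʳ (G N n m x) ⟩
    G N n m x ∎

  -- Stability taken down to the empty sum.
  G-vanish : ∀ N n m x → n ℕ.< m → G N n m x ≈ 0#
  G-vanish zero    n m x h = refl
  G-vanish (suc N) n m x h = begin
    G (suc N) n m x   ≡⟨ ≡.cong (λ k → G (suc k) n m x) (ℕ.+-identityʳ N) ⟨
    G (suc N ℕ.+ 0) n m x ≈⟨ G-stable (suc N) 0 n m x h ⟩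
    0#                ∎

  private
    swap : ∀ a b c → a * (b * c) ≈ b * (a * c)
    swap a b c = begin
      a * (b * c)   ≈⟨ *-assoc a b c ⟨
      a * b * c     ≈⟨ *-congʳ (*-comm a b) ⟩
      b * a * c     ≈⟨ *-assoc b a c ⟩
      b * (a * c)   ∎

  G-suc-zero : ∀ M n x → n ℕ.< M → G (suc M) (suc n) 0 x ≈ (x + nat n) * G (suc M) n 0 x
  G-suc-zero M n x h = begin
    nat 0 * 1# + ∑ M (λ i → nat (coefficient (suc n) 0 (suc i)) * x ^ suc i)
      ≈⟨ +-cong (nat-vanish ≡.refl 1#) (∑-cong M step) ⟩
    0# + ∑ M (λ i → nat n * (nat (coefficient n 0 (suc i)) * x ^ suc i) + x * (nat (coefficient n 0 i) * x ^ i))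
      -- The vanished head is put back as n · [n,0], which completes the sum that `nat n`
      -- multiplies.
      ≈⟨ +-cong (sym head≈0) (∑-+ M (λ i → nat n * u (suc i)) (λ i → x * u i)) ⟩
    nat n * (nat (coefficient n 0 0) * 1#) +
      (∑ M (λ i → nat n * (nat (coefficient n 0 (suc i)) * x ^ suc i)) + ∑ M (λ i → x * (nat (coefficient n 0 i) * x ^ i)))
      ≈⟨ +-congˡ (+-cong (∑-* M (nat n) (u ∘ suc)) (∑-* M x u)) ⟩
    nat n * (nat (coefficient n 0 0) * 1#) +
      (nat n * ∑ M (λ i → nat (coefficient n 0 (suc i)) * x ^ suc i) + x * G M n 0 x)
      ≈⟨ +-assoc _ _ _ ⟨
    nat n * (nat (coefficient n 0 0) * 1#) + nat n * ∑ M (λ i → nat (coefficient n 0 (suc i)) * x ^ suc i) + x * G M n 0 x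
      -- The index shift leaves `M` terms beside `x`. Since `n ℕ.< M`, the term of index `M` is zero
      -- and can be restored.
      ≈⟨ +-cong (sym (distribˡ (nat n) _ _)) (*-congˡ (sym (G-stable 1 M n 0 x (≡.subst (n ℕ.<_) (≡.sym (ℕ.+-identityʳ M)) h)))) ⟩
    nat n * G (suc M) n 0 x + x * G (suc M) n 0 x
      ≈⟨ +-comm _ _ ⟩
    x * G (suc M) n 0 x + nat n * G (suc M) n 0 x
      ≈⟨ distribʳ (G (suc M) n 0 x) x (nat n) ⟨
    (x + nat n) * G (suc M) n 0 x ∎
    where
    u : ℕ → Carrier
    u i = nat (coefficient n 0 i) * x ^ i

    head≈0 : nat n * (nat (coefficient n 0 0) * 1#) ≈ 0#
    head≈0 = begin
      nat n * (nat (coefficient n 0 0) * 1#)     ≈⟨ *-assoc (nat n) _ 1# ⟨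
      nat n * nat (coefficient n 0 0) * 1#       ≈⟨ *-congʳ (nat-* n (coefficient n 0 0)) ⟨
      nat (n ℕ.* coefficient n 0 0) * 1#
        ≈⟨ nat-vanish (≡.trans (≡.cong (n ℕ.*_) (ℕ.*-identityˡ (stirling₁ n 0))) (n*stirling₁[n,0]≡0 n)) 1# ⟩
      0#                                         ∎

    step : ∀ i → nat (coefficient (suc n) 0 (suc i)) * x ^ suc i ≈
                 nat n * (nat (coefficient n 0 (suc i)) * x ^ suc i) + x * (nat (coefficient n 0 i) * x ^ i)
    step i = begin
      nat (coefficient (suc n) 0 (suc i)) * x ^ suc i
        ≡⟨ ≡.cong (λ c → nat c * x ^ suc i) (coefficient-zero-suc n i) ⟩
      nat (n ℕ.* p ℕ.+ q) * x ^ suc i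
        ≈⟨ *-congʳ (trans (nat-+ (n ℕ.* p) q) (+-congʳ (nat-* n p))) ⟩
      (nat n * nat p + nat q) * x ^ suc i
        ≈⟨ distribʳ (x ^ suc i) _ (nat q) ⟩
      nat n * nat p * x ^ suc i + nat q * (x * x ^ i)
        ≈⟨ +-cong (*-assoc (nat n) (nat p) (x ^ suc i)) (swap (nat q) x (x ^ i)) ⟩
      nat n * (nat p * x ^ suc i) + x * (nat q * x ^ i) ∎
      where
      p q : ℕ
      p = coefficient n 0 (suc i)
      q = coefficient n 0 i

  -- Of the three parts given by `coefficient-suc`, two are at once the sums wanted. The third, `r`,
  -- begins with C(m, m+1) = 0 and after a shift by one index is `x` times the sum for `suc m`.
  G-suc-suc : ∀ M n m x → n ℕ.< M →
    G (suc M) (suc n) (suc m) x ≈ (x + nat n) * G (suc M) n (suc m) x + G (suc M) n m x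
  G-suc-suc M n m x h = begin
    ∑ (suc M) (λ i → nat (coefficient (suc n) (suc m) i) * x ^ i)
      ≈⟨ ∑-cong (suc M) step ⟩
    ∑ (suc M) (λ i → (nat n * (nat (coefficient n (suc m) i) * x ^ i) + nat (coefficient n m i) * x ^ i) + nat (r i) * x ^ i)
      ≈⟨ ∑-+ (suc M) (λ i → nat n * v i + u i) (λ i → nat (r i) * x ^ i) ⟩
    ∑ (suc M) (λ i → nat n * (nat (coefficient n (suc m) i) * x ^ i) + nat (coefficient n m i) * x ^ i) +
      ∑ (suc M) (λ i → nat (r i) * x ^ i)
      ≈⟨ +-cong (trans (∑-+ (suc M) (λ i → nat n * v i) u) (+-congʳ (∑-* (suc M) (nat n) v))) remainder ⟩
    (nat n * G (suc M) n (suc m) x + G (suc M) n m x) + x * G (suc M) n (suc m) x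
      ≈⟨ +-comm _ _ ⟩
    x * G (suc M) n (suc m) x + (nat n * G (suc M) n (suc m) x + G (suc M) n m x)
      ≈⟨ +-assoc _ _ _ ⟨
    x * G (suc M) n (suc m) x + nat n * G (suc M) n (suc m) x + G (suc M) n m x
      ≈⟨ +-congʳ (distribʳ (G (suc M) n (suc m) x) x (nat n)) ⟨
    (x + nat n) * G (suc M) n (suc m) x + G (suc M) n m x ∎
    where
    u v : ℕ → Carrier
    u i = nat (coefficient n m i) * x ^ i
    v i = nat (coefficient n (suc m) i) * x ^ i

    r : ℕ → ℕ
    r i = ((i ℕ.+ m) C suc m) ℕ.* stirling₁ n (i ℕ.+ m)

    step : ∀ i → nat (coefficient (suc n) (suc m) i) * x ^ i ≈
      (nat n * (nat (coefficient n (suc m) i) * x ^ i) + nat (coefficient n m i) * x ^ i) + nat (r i) * x ^ i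
    step i = begin
      nat (coefficient (suc n) (suc m) i) * x ^ i
        ≡⟨ ≡.cong (λ c → nat c * x ^ i) (coefficient-suc n m i) ⟩
      nat ((n ℕ.* p ℕ.+ q) ℕ.+ r i) * x ^ i
        ≈⟨ *-congʳ (trans (nat-+ (n ℕ.* p ℕ.+ q) (r i)) (+-congʳ (trans (nat-+ (n ℕ.* p) q) (+-congʳ (nat-* n p))))) ⟩
      (nat n * nat p + nat q + nat (r i)) * x ^ i
        ≈⟨ trans (distribʳ (x ^ i) _ _) (+-congʳ (distribʳ (x ^ i) _ _)) ⟩
      nat n * nat p * x ^ i + nat q * x ^ i + nat (r i) * x ^ i
        ≈⟨ +-congʳ (+-congʳ (*-assoc (nat n) (nat p) (x ^ i))) ⟩
      nat n * (nat p * x ^ i) + nat q * x ^ i + nat (r i) * x ^ i ∎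
      where
      p q : ℕ
      p = coefficient n (suc m) i
      q = coefficient n m i

    r-suc : ∀ i → r (suc i) ≡ coefficient n (suc m) i
    r-suc i = ≡.cong (λ j → (j C suc m) ℕ.* stirling₁ n j) (≡.sym (ℕ.+-suc i m))

    remainder : ∑ (suc M) (λ i → nat (r i) * x ^ i) ≈ x * G (suc M) n (suc m) x
    remainder = begin
      nat (r 0) * 1# + ∑ M (λ i → nat (r (suc i)) * (x * x ^ i))
        ≈⟨ +-cong (nat-vanish (≡.cong (ℕ._* stirling₁ n m) (k>n⇒nCk≡0 (ℕ.n<1+n m))) 1#)
             (∑-cong M λ i → trans (*-congʳ (reflexive (≡.cong nat (r-suc i)))) (swap (nat (coefficient n (suc m) i)) x (x ^ i))) ⟩
      0# + ∑ M (λ i → x * (nat (coefficient n (suc m) i) * x ^ i))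
        ≈⟨ +-identityˡ _ ⟩
      ∑ M (λ i → x * (nat (coefficient n (suc m) i) * x ^ i))
        ≈⟨ ∑-* M x v ⟩
      x * G M n (suc m) x
        ≈⟨ *-congˡ (G-stable 1 M n (suc m) x (ℕ.≤-trans h (ℕ.m≤m+n M (suc m)))) ⟨
      x * G (suc M) n (suc m) x ∎

  risingFactorial : Carrier → ℕ → Carrier
  risingFactorial z n = product {n} λ i → z + nat (toℕ i)

  -- `M` stays fixed while `n` varies, so all sums in the induction have the same length.
  -- Multiplication by `y` pushes out only the term of index `M`, whose coefficient vanishes because
  -- `n` is below `M` in the step.
  risingFactorial-expansion : ∀ M n x y → n ℕ.≤ M →
    risingFactorial (x + y) n ≈ ∑ (suc M) λ m → G (suc M) n m x * y ^ m
  risingFactorial-expansion M zero x y _ = sym (begin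
    (nat 1 * 1# + ∑ M (λ i → nat (coefficient 0 0 (suc i)) * x ^ suc i)) * 1# + ∑ M (λ m → G (suc M) 0 (suc m) x * y ^ suc m)
      ≈⟨ +-cong (*-congʳ (+-cong (*-congʳ (trans (nat-suc 0) (trans (+-congˡ nat-zero) (+-identityʳ 1#))))
           (trans (∑-cong M λ i → nat-vanish (coefficient-vanish 0 0 (suc i) (ℕ.s≤s ℕ.z≤n)) (x ^ suc i)) (∑-zero M))))
           (trans (∑-cong M λ m → trans (*-congʳ (G-vanish (suc M) 0 (suc m) x (ℕ.s≤s ℕ.z≤n))) (zeroˡ (y ^ suc m))) (∑-zero M)) ⟩
    (1# * 1# + 0#) * 1# + 0#
      ≈⟨ +-identityʳ _ ⟩
    (1# * 1# + 0#) * 1#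
      ≈⟨ trans (*-identityʳ _) (+-identityʳ _) ⟩
    1# * 1#
      ≈⟨ *-identityʳ 1# ⟩
    1# ∎)
    where
    ∑-zero : ∀ n → ∑ n (λ _ → 0#) ≈ 0#
    ∑-zero zero    = refl
    ∑-zero (suc n) = trans (+-identityˡ _) (∑-zero n)
  risingFactorial-expansion M (suc n) x y n<M = begin
    risingFactorial (x + y) (suc n)
      ≈⟨ sum-last *-monoid n (λ i → x + y + nat i) ⟩
    risingFactorial (x + y) n * (x + y + nat n)
      ≈⟨ *-cong (risingFactorial-expansion M n x y (ℕ.<⇒≤ n<M)) regroup ⟩
    S * (x + nat n + y)
      ≈⟨ trans (*-comm _ _) (distribʳ S (x + nat n) y) ⟩
    (x + nat n) * S + y * S
      ≈⟨ +-cong (distribˡ (x + nat n) _ _) shifted ⟩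
    ((x + nat n) * (g 0 * 1#) + (x + nat n) * ∑ M (λ m → g (suc m) * y ^ suc m)) + ∑ M (λ m → g m * y ^ suc m)
      ≈⟨ +-assoc _ _ _ ⟩
    (x + nat n) * (g 0 * 1#) + ((x + nat n) * ∑ M (λ m → g (suc m) * y ^ suc m) + ∑ M (λ m → g m * y ^ suc m))
      ≈⟨ +-cong (trans (sym (*-assoc _ _ _)) (*-congʳ (sym (G-suc-zero M n x n<M)))) (+-congʳ (sym (∑-* M (x + nat n) (λ m → g (suc m) * y ^ suc m)))) ⟩
    G (suc M) (suc n) 0 x * 1# + (∑ M (λ m → (x + nat n) * (g (suc m) * y ^ suc m)) + ∑ M (λ m → g m * y ^ suc m))
      ≈⟨ +-congˡ (∑-+ M (λ m → (x + nat n) * (g (suc m) * y ^ suc m)) (λ m → g m * y ^ suc m)) ⟨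
    G (suc M) (suc n) 0 x * 1# + ∑ M (λ m → (x + nat n) * (g (suc m) * y ^ suc m) + g m * y ^ suc m)
      ≈⟨ +-congˡ (∑-cong M λ m → begin
           (x + nat n) * (g (suc m) * y ^ suc m) + g m * y ^ suc m   ≈⟨ +-congʳ (*-assoc _ _ _) ⟨
           (x + nat n) * g (suc m) * y ^ suc m + g m * y ^ suc m     ≈⟨ distribʳ (y ^ suc m) _ _ ⟨
           ((x + nat n) * g (suc m) + g m) * y ^ suc m               ≈⟨ *-congʳ (G-suc-suc M n m x n<M) ⟨
           G (suc M) (suc n) (suc m) x * y ^ suc m                   ∎) ⟩
    ∑ (suc M) (λ m → G (suc M) (suc n) m x * y ^ m) ∎
    where
    g : ℕ → Carrier
    g m = G (suc M) n m x

    S : Carrier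
    S = ∑ (suc M) λ m → g m * y ^ m

    regroup : x + y + nat n ≈ x + nat n + y
    regroup = trans (+-assoc x y (nat n)) (trans (+-congˡ (+-comm y (nat n))) (sym (+-assoc x (nat n) y)))

    shifted : y * S ≈ ∑ M (λ m → g m * y ^ suc m)
    shifted = begin
      y * S                                         ≈⟨ ∑-* (suc M) y (λ m → g m * y ^ m) ⟨
      ∑ (suc M) (λ m → y * (g m * y ^ m))           ≈⟨ ∑-cong (suc M) (λ m → swap y (g m) (y ^ m)) ⟩
      ∑ (suc M) (λ m → g m * y ^ suc m)             ≈⟨ ∑-last M (λ m → g m * y ^ suc m) ⟩
      ∑ M (λ m → g m * y ^ suc m) + g M * y ^ suc M
        ≈⟨ +-congˡ (trans (*-congʳ (G-vanish (suc M) n M x n<M)) (zeroˡ (y ^ suc M))) ⟩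
      ∑ M (λ m → g m * y ^ suc m) + 0#              ≈⟨ +-identityʳ _ ⟩
      ∑ M (λ m → g m * y ^ suc m)                   ∎

-- Integration over the cube and the two expansions, for abstract operations.

-- The operations of Defs enter as variables with their defining equations.  Agda
-- compares two reals by unfolding them down to the proofs of the Cauchy property,
-- which is feasible for single steps only; proofs about composite expressions are
-- therefore given for variables, and instantiation yields them for ℝ as they stand.
module Restatement
    {A : Set} {_≃_ _≼_ : A → A → Set} {_⊕_ _⊗_ : A → A → A} {⊝_ ∣_∣ : A → A} {𝟘 𝟙 : A} {fromℚ : ℚ → A}
    (isOrderedℚAlgebra : IsOrderedℚAlgebra _≃_ _≼_ _⊕_ _⊗_ ⊝_ ∣_∣ 𝟘 𝟙 fromℚ)
    (_⊖_ : A → A → A) (⊖-def : ∀ x y → (x ⊖ y) ≃ (x ⊕ (⊝ y)))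
    (natᴿ : ℕ → A) (natᴿ-def : ∀ n → natᴿ n ≃ fromℚ (+ n ℚ./ 1))
    (recipᴿ : (d : ℕ) .{{_ : ℕ.NonZero d}} → A)
    (recipᴿ-def : ∀ d .{{_ : ℕ.NonZero d}} → recipᴿ d ≃ fromℚ (+ 1 ℚ./ d))
    (sumᴿ : ∀ {n} → (Fin n → A) → A) (sumᴿ-zero : ∀ v → sumᴿ {0} v ≃ 𝟘)
    (sumᴿ-suc : ∀ {n} v → sumᴿ {suc n} v ≃ (v fzero ⊕ sumᴿ (v ∘ fsuc)))
    (productᴿ : ∀ {n} → (Fin n → A) → A) (productᴿ-zero : ∀ v → productᴿ {0} v ≃ 𝟙)
    (productᴿ-suc : ∀ {n} v → productᴿ {suc n} v ≃ (v fzero ⊗ productᴿ (v ∘ fsuc)))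
    (_^ᴿ_ : A → ℕ → A) (^ᴿ-zero : ∀ x → (x ^ᴿ 0) ≃ 𝟙) (^ᴿ-suc : ∀ x n → (x ^ᴿ suc n) ≃ (x ⊗ (x ^ᴿ n)))
    (sum≤ᴿ : ℕ → (ℕ → A) → A) (sum≤ᴿ-def : ∀ n a → sum≤ᴿ n a ≃ sumᴿ {suc n} (a ∘ toℕ))
    (genStirlingᴿ : ℕ → ℕ → A → A)
    (genStirlingᴿ-def : ∀ n m x → genStirlingᴿ n m x ≃ sum≤ᴿ (n ∸ m) (λ i → natᴿ (((i ℕ.+ m) C m) ℕ.* stirling₁ n (i ℕ.+ m)) ⊗ (x ^ᴿ i)))
    (recip^ᴿ : ℕ → ℕ → A)
    (recip^ᴿ-def : ∀ m k → recip^ᴿ m k ≃ recipᴿ (suc m ℕ.^ k) {{ℕ.m^n≢0 (suc m) k}})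
    where

  open IsOrderedℚAlgebra isOrderedℚAlgebra using (fromℚ-0; fromℚ-1; fromℚ-mono-≤)
  open OrderedℚAlgebra isOrderedℚAlgebra
  open CommutativeRing commutativeRing
  open RingProperties ring using (-1*x≈-x; -‿involutive; -‿+-comm)
  open Exp semiring using (_^_; ^-congˡ; ^-homo-*)
  open CommutativeExp commutativeSemiring using (^-distrib-*)
  open SemiringSum semiring using (sum; sum-cong-≋)
  open MonoidSum *-monoid using () renaming (sum to product; sum-cong-≋ to product-cong-≋)
  open Stirling commutativeRing nat fromℚ-0 nat-suc
  open Poset poset using (≤-respˡ-≈) renaming (refl to ≤-refl; reflexive to ≤-reflexive; trans to ≤-trans)
  open import Relation.Binary.Reasoning.Setoid setoid

  private
    sumᴿ≈sum : ∀ {n} (v : Fin n → A) → sumᴿ v ≈ sum v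
    sumᴿ≈sum {zero}  v = sumᴿ-zero v
    sumᴿ≈sum {suc n} v = trans (sumᴿ-suc v) (+-congˡ (sumᴿ≈sum (v ∘ fsuc)))

    productᴿ≈product : ∀ {n} (v : Fin n → A) → productᴿ v ≈ product v
    productᴿ≈product {zero}  v = productᴿ-zero v
    productᴿ≈product {suc n} v = trans (productᴿ-suc v) (*-congˡ (productᴿ≈product (v ∘ fsuc)))

    ^ᴿ≈^ : ∀ x n → (x ^ᴿ n) ≈ x ^ n
    ^ᴿ≈^ x zero    = ^ᴿ-zero x
    ^ᴿ≈^ x (suc n) = trans (^ᴿ-suc x n) (*-congˡ (^ᴿ≈^ x n))

    sum≤ᴿ≈∑ : ∀ n a → sum≤ᴿ n a ≈ ∑ (suc n) a
    sum≤ᴿ≈∑ n a = trans (sum≤ᴿ-def n a) (sumᴿ≈sum {suc n} (a ∘ toℕ))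

    to-∑ : ∀ n {a b : ℕ → A} → (∀ {m} → m ℕ.≤ n → a m ≈ b m) → sum≤ᴿ n a ≈ ∑ (suc n) b
    to-∑ n {a} {b} h = trans (sum≤ᴿ≈∑ n a) (sum-cong-≋ {suc n} λ i → h (ℕ.s≤s⁻¹ (toℕ<n i)))

    interchange : ∀ a b c → a * b * c ≈ a * c * b
    interchange a b c = trans (*-assoc a b c) (trans (*-congˡ (*-comm b c)) (sym (*-assoc a c b)))

    1^ : ∀ m → 1# ^ m ≈ 1#
    1^ zero    = refl
    1^ (suc m) = trans (*-identityˡ (1# ^ m)) (1^ m)

  sum≤ᴿ-cong : ∀ n {a b : ℕ → A} → (∀ m → a m ≃ b m) → sum≤ᴿ n a ≃ sum≤ᴿ n b
  sum≤ᴿ-cong n {a} {b} h = trans (to-∑ n {a} {b} λ {m} _ → h m) (sym (sum≤ᴿ≈∑ n b))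

  -- The partition arrives as separate components, so that the fields of `TaggedPartition` can be
  -- supplied directly and `S` can stand for `riemannSum`.
  polynomial-integral : ∀ n (a : ℕ → A) (f : A → A) →
    (∀ t → f t ≃ sum≤ᴿ n (λ m → a m ⊗ (t ^ᴿ m))) →
    ∀ I → I ≃ sum≤ᴿ n (λ m → a m ⊗ recipᴿ (suc m)) →
    ∀ ε → 0ℚ ℚ.< ε → ∃ λ δ → 0ℚ ℚ.< δ ×
    (∀ {r} (x : Fin (suc r) → A) (τ w : Fin r → A) S →
     x fzero ≃ 𝟘 → x (flast r) ≃ 𝟙 →
     (∀ i → x (inject₁ i) ≼ τ i) → (∀ i → τ i ≼ x (fsuc i)) →
     (∀ i → w i ≃ (x (fsuc i) ⊖ x (inject₁ i))) →
     S ≃ sumᴿ (λ i → f (τ i) ⊗ w i) →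
     (∀ i → w i ≼ fromℚ δ) → ∣ S ⊖ I ∣ ≼ fromℚ ε)
  polynomial-integral n a f f≈ I I≈ ε 0<ε =
    let δ , 0<δ , close = integral d ε 0<ε
    in δ , 0<δ , λ x τ w S x0 x1 lo up w≈ S≈ w≤δ →
       ≤-respˡ-≈ (∣∣-cong (begin
         sum (λ i → p (τ i) * w i) - (P 1# - P 0#)
           ≈⟨ +-cong (sum-cong-≋ λ i → *-congʳ (p≈f (τ i))) (-‿cong P1-P0) ⟩
         sum (λ i → f (τ i) * w i) - I
           ≈⟨ +-congʳ (trans S≈ (sumᴿ≈sum (λ i → f (τ i) * w i))) ⟨
         S - I
           ≈⟨ ⊖-def S I ⟨
         S ⊖ I ∎))
       (close {x = x} (record
         { first = x0
         ; last  = x1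
         ; lower = lo
         ; upper = up
         ; width = λ i → trans (w≈ i) (⊖-def (x (fsuc i)) (x (inject₁ i)))
         }) w≤δ)
    where
    p P : A → A
    p t = ∑ (suc n) λ m → a m * t ^ m
    P t = ∑ (suc n) λ m → a m * (recip (suc m) * t ^ suc m)

    d : Antiderivative p P (λ t → ∑ (suc n) λ m → ∣ a m ∣ * t ^ m)
    d = sum-antiderivative {suc n} λ i → scale (a (toℕ i)) (monomial (toℕ i))

    p≈f : ∀ t → p t ≈ f t
    p≈f t = sym (trans (f≈ t) (to-∑ n λ {m} _ → *-congˡ (^ᴿ≈^ t m)))

    P0 : P 0# ≈ 0#
    P0 = begin
      P 0#
        -- Each summand is written as 0 · 0 so that `∑-*` can pull out a zero factor.
        ≈⟨ ∑-cong (suc n) (λ m → trans (*-congˡ (trans (*-congˡ (zeroˡ (0# ^ m))) (zeroʳ (recip (suc m))))) (trans (zeroʳ (a m)) (sym (zeroˡ 0#)))) ⟩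
      ∑ (suc n) (λ _ → 0# * 0#)   ≈⟨ ∑-* (suc n) 0# (λ _ → 0#) ⟩
      0# * ∑ (suc n) (λ _ → 0#)   ≈⟨ zeroˡ _ ⟩
      0#                          ∎

    P1-P0 : P 1# - P 0# ≈ I
    P1-P0 = begin
      P 1# - P 0#   ≈⟨ +-congˡ (trans (-‿cong P0) (trans (sym (+-identityˡ (- 0#))) (-‿inverseʳ 0#))) ⟩
      P 1# + 0#     ≈⟨ +-identityʳ (P 1#) ⟩
      P 1#          ≈⟨ ∑-cong (suc n) (λ m → *-congˡ {a m} (trans (*-congˡ (1^ (suc m))) (*-identityʳ (recip (suc m))))) ⟩
      ∑ (suc n) (λ m → a m * recip (suc m))   ≈⟨ to-∑ n (λ {m} _ → *-congˡ (recipᴿ-def (suc m))) ⟨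
      sum≤ᴿ n (λ m → a m * recipᴿ (suc m))    ≈⟨ I≈ ⟨
      I ∎

  uniform-partition : ∀ {δ δ′} → 0ℚ ℚ.< δ → 0ℚ ℚ.< δ′ →
    ∃ λ r → ∃ λ (x : Fin (suc r) → A) → ∃ λ (τ : Fin r → A) →
    x fzero ≃ 𝟘 × x (flast r) ≃ 𝟙 ×
    (∀ i → x (inject₁ i) ≼ τ i) × (∀ i → τ i ≼ x (fsuc i)) ×
    (∀ i → 𝟘 ≼ τ i × τ i ≼ 𝟙) ×
    (∀ i → (x (fsuc i) ⊖ x (inject₁ i)) ≼ fromℚ δ) ×
    (∀ i → (x (fsuc i) ⊖ x (inject₁ i)) ≼ fromℚ δ′)
  uniform-partition {δ} {δ′} 0<δ 0<δ′ =
    let d , d≤δ , d≤δ′ = archimedean₂ 0<δ 0<δ′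
        open Uniform d
        width≤ : ∀ {q} → (+ 1 ℚ./ suc d) ℚ.≤ q → ∀ i → (point (fsuc i) ⊖ tag i) ≼ fromℚ q
        width≤ d≤q i = ≤-trans (≤-reflexive (trans (⊖-def (point (fsuc i)) (tag i)) (width≈recip i))) (fromℚ-mono-≤ d≤q)
    in suc d , point , tag , point-first , point-last , (λ _ → ≤-refl) , tag≤point ,
       (λ i → 0≤point (inject₁ i) , tag≤1 i) , width≤ d≤δ , width≤ d≤δ′

  riemann-sum-cong : ∀ {r} (f g : A → A) (τ w : Fin r → A) → (∀ i → f (τ i) ≃ g (τ i)) →
    ∀ S T → S ≃ sumᴿ (λ i → f (τ i) ⊗ w i) → T ≃ sumᴿ (λ i → g (τ i) ⊗ w i) → S ≃ T
  riemann-sum-cong {r} f g τ w h S T S≈ T≈ = begin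
    S                              ≈⟨ trans S≈ (sumᴿ≈sum (λ i → f (τ i) * w i)) ⟩
    sum (λ i → f (τ i) * w i)      ≈⟨ sum-cong-≋ (λ i → *-congʳ (h i)) ⟩
    sum (λ i → g (τ i) * w i)      ≈⟨ trans T≈ (sumᴿ≈sum (λ i → g (τ i) * w i)) ⟨
    T                              ∎

  limits-agree : ∀ {I J} → (∀ ε → 0ℚ ℚ.< ε → ∃ λ S → ∃ λ T →
    S ≃ T × ∣ S ⊖ I ∣ ≼ fromℚ ε × ∣ T ⊖ J ∣ ≼ fromℚ ε) → I ≃ J
  limits-agree {I} {J} h = close⇒≈ λ ε 0<ε →
    let S , T , S≈T , p , q = h ε 0<ε in
    S , ≤-respˡ-≈ (∣∣-cong (⊖-def S I)) p ,
        ≤-respˡ-≈ (∣∣-cong (trans (⊖-def T J) (+-congʳ (sym S≈T)))) q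

  cube-zero : ∀ n (a : ℕ → A) p f I → p ≃ 𝟙 → f ≃ sum≤ᴿ n (λ m → a m ⊗ (p ^ᴿ m)) →
    I ≃ sum≤ᴿ n (λ m → a m ⊗ recip^ᴿ m 0) → f ≃ I
  cube-zero n a p f I p≈1 f≈ I≈ = begin
    f                                      ≈⟨ f≈ ⟩
    sum≤ᴿ n (λ m → a m * (p ^ᴿ m))         ≈⟨ sum≤ᴿ-cong n (λ m → *-congˡ (trans (p^m≈1 m) (sym (one m)))) ⟩
    sum≤ᴿ n (λ m → a m * recip^ᴿ m 0)      ≈⟨ I≈ ⟨
    I                                      ∎
    where
    p^m≈1 : ∀ m → (p ^ᴿ m) ≈ 1#
    p^m≈1 m = trans (^ᴿ≈^ p m) (trans (^-congˡ m p≈1) (1^ m))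

    one : ∀ m → recip^ᴿ m 0 ≈ 1#
    one m = trans (recip^ᴿ-def m 0) (trans (recipᴿ-def 1) fromℚ-1)

  -- With the later variables fixed and `p` their product, the integrand is a polynomial in the
  -- first variable `t` alone, with coefficients `a m ⊗ (p ^ᴿ m)`.
  cube-integrand : ∀ n (a : ℕ → A) q t p f → q ≃ (t ⊗ p) → f ≃ sum≤ᴿ n (λ m → a m ⊗ (q ^ᴿ m)) →
    f ≃ sum≤ᴿ n (λ m → (a m ⊗ (p ^ᴿ m)) ⊗ (t ^ᴿ m))
  cube-integrand n a q t p f q≈ f≈ = trans f≈ (sum≤ᴿ-cong n λ m → begin
    a m * (q ^ᴿ m)                ≈⟨ *-congˡ (trans (^ᴿ≈^ q m) (trans (^-congˡ m q≈) (^-distrib-* t p m))) ⟩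
    a m * (t ^ m * p ^ m)         ≈⟨ *-congˡ (*-comm (t ^ m) (p ^ m)) ⟩
    a m * (p ^ m * t ^ m)         ≈⟨ *-assoc (a m) (p ^ m) (t ^ m) ⟨
    a m * p ^ m * t ^ m           ≈⟨ *-cong (*-congˡ (^ᴿ≈^ p m)) (^ᴿ≈^ t m) ⟨
    a m * (p ^ᴿ m) * (t ^ᴿ m)     ∎)

  cube-inner : ∀ n (a : ℕ → A) p →
    sum≤ᴿ n (λ m → (a m ⊗ recipᴿ (suc m)) ⊗ (p ^ᴿ m)) ≃ sum≤ᴿ n (λ m → (a m ⊗ (p ^ᴿ m)) ⊗ recipᴿ (suc m))
  cube-inner n a p = sum≤ᴿ-cong n λ m → interchange (a m) (recipᴿ (suc m)) (p ^ᴿ m)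

  -- All three reciprocals are rational constants of their own, so the argument is uniqueness of
  -- inverses: r = r(sp)(tq) = (r · pq)(st) = st.
  recip^ᴿ-suc : ∀ m k → recip^ᴿ m (suc k) ≈ recipᴿ (suc m) * recip^ᴿ m k
  recip^ᴿ-suc m k = begin
    recip^ᴿ m (suc k)                      ≈⟨ trans (recip^ᴿ-def m (suc k)) (recipᴿ-def (p ℕ.* q) {{ℕ.m^n≢0 p (suc k)}}) ⟩
    r                                      ≈⟨ *-identityʳ r ⟨
    r * 1#                                 ≈⟨ *-congˡ (trans (*-cong (recip*nat p) (recip*nat q {{ℕ.m^n≢0 p k}})) (*-identityʳ 1#)) ⟨
    r * ((s * nat p) * (t * nat q))        ≈⟨ *-congˡ (regroup s (nat p) t (nat q)) ⟩
    r * ((s * t) * (nat p * nat q))        ≈⟨ trans (sym (*-assoc r (s * t) _)) (interchange r (s * t) _) ⟩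
    r * (nat p * nat q) * (s * t)          ≈⟨ *-congʳ (*-congˡ (nat-* p q)) ⟨
    r * nat (p ℕ.* q) * (s * t)            ≈⟨ *-congʳ (recip*nat (p ℕ.* q) {{ℕ.m^n≢0 p (suc k)}}) ⟩
    1# * (s * t)                           ≈⟨ *-identityˡ (s * t) ⟩
    s * t                                  ≈⟨ *-cong (recipᴿ-def p) (trans (recip^ᴿ-def m k) (recipᴿ-def q {{ℕ.m^n≢0 p k}})) ⟨
    recipᴿ (suc m) * recip^ᴿ m k           ∎
    where
    p q : ℕ
    p = suc m
    q = suc m ℕ.^ k
    r s t : A
    r = recip (p ℕ.* q) {{ℕ.m^n≢0 p (suc k)}}
    s = recip p
    t = recip q {{ℕ.m^n≢0 p k}}

    regroup : ∀ a b c d → (a * b) * (c * d) ≈ (a * c) * (b * d)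
    regroup a b c d = begin
      (a * b) * (c * d)   ≈⟨ *-assoc (a * b) c d ⟨
      a * b * c * d       ≈⟨ *-congʳ (interchange a b c) ⟩
      a * c * b * d       ≈⟨ *-assoc (a * c) b d ⟩
      (a * c) * (b * d)   ∎

  cube-value : ∀ n k (a : ℕ → A) → sum≤ᴿ n (λ m → a m ⊗ recip^ᴿ m (suc k)) ≃
    sum≤ᴿ n (λ m → (a m ⊗ recipᴿ (suc m)) ⊗ recip^ᴿ m k)
  cube-value n k a = sum≤ᴿ-cong n λ m →
    trans (*-congˡ (recip^ᴿ-suc m k)) (sym (*-assoc (a m) (recipᴿ (suc m)) (recip^ᴿ m k)))

  scaled-expansion : ∀ n (a : ℕ → A) f p d → f ≃ sum≤ᴿ n (λ m → a m ⊗ (p ^ᴿ m)) →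
    (f ⊗ d) ≃ sum≤ᴿ n (λ m → (a m ⊗ d) ⊗ (p ^ᴿ m))
  scaled-expansion n a f p d f≈ = begin
    f * d
      ≈⟨ *-congʳ (trans f≈ (sum≤ᴿ≈∑ n _)) ⟩
    ∑ (suc n) (λ m → a m * (p ^ᴿ m)) * d
      ≈⟨ trans (*-comm _ d) (sym (∑-* (suc n) d (λ m → a m * (p ^ᴿ m)))) ⟩
    ∑ (suc n) (λ m → d * (a m * (p ^ᴿ m)))
      ≈⟨ to-∑ n (λ {m} _ → trans (*-congʳ (*-comm (a m) d)) (*-assoc d (a m) (p ^ᴿ m))) ⟨
    sum≤ᴿ n (λ m → (a m * d) * (p ^ᴿ m)) ∎

  -- The factor n! of the poly-Cauchy value cancels the 1/n! of the binomial, which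
  -- `scaled-expansion` has moved into the coefficients.
  unscale : ∀ n k (a : ℕ → A) d .{{_ : ℕ.NonZero d}} →
    (natᴿ d ⊗ sum≤ᴿ n (λ m → (a m ⊗ recipᴿ d) ⊗ recip^ᴿ m k)) ≃ sum≤ᴿ n (λ m → a m ⊗ recip^ᴿ m k)
  unscale n k a d = begin
    natᴿ d * sum≤ᴿ n (λ m → (a m * recipᴿ d) * recip^ᴿ m k)
      ≈⟨ *-cong (natᴿ-def d) (sum≤ᴿ≈∑ n _) ⟩
    nat d * ∑ (suc n) (λ m → (a m * recipᴿ d) * recip^ᴿ m k)
      ≈⟨ ∑-* (suc n) (nat d) (λ m → (a m * recipᴿ d) * recip^ᴿ m k) ⟨
    ∑ (suc n) (λ m → nat d * ((a m * recipᴿ d) * recip^ᴿ m k))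
      ≈⟨ to-∑ n (λ {m} _ → sym (step m)) ⟨
    sum≤ᴿ n (λ m → a m * recip^ᴿ m k) ∎
    where
    step : ∀ m → nat d * ((a m * recipᴿ d) * recip^ᴿ m k) ≈ a m * recip^ᴿ m k
    step m = begin
      nat d * ((a m * recipᴿ d) * recip^ᴿ m k)   ≈⟨ *-comm _ _ ⟩
      a m * recipᴿ d * recip^ᴿ m k * nat d       ≈⟨ interchange _ _ _ ⟩
      a m * recipᴿ d * nat d * recip^ᴿ m k
        ≈⟨ *-congʳ (trans (*-assoc _ _ _) (*-congˡ (trans (*-congʳ (recipᴿ-def d)) (recip*nat d)))) ⟩
      a m * 1# * recip^ᴿ m k                     ≈⟨ *-congʳ (*-identityʳ (a m)) ⟩
      a m * recip^ᴿ m k                          ∎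

  private
    -- `genStirlingᴿ` stops at i = n - m whereas `G` runs on to i = n; the `m` further terms are
    -- zero.
    G≈genStirling : ∀ {n m} x → m ℕ.≤ n → G (suc n) n m x ≈ genStirlingᴿ n m x
    G≈genStirling {n} {m} x m≤n = begin
      G (suc n) n m x
        ≡⟨ ≡.cong (λ N → G N n m x) (≡.trans (ℕ.+-suc m (n ∸ m)) (≡.cong suc (ℕ.m+[n∸m]≡n m≤n))) ⟨
      G (m ℕ.+ suc (n ∸ m)) n m x
        ≈⟨ G-stable m (suc (n ∸ m)) n m x (ℕ.s≤s (ℕ.≤-reflexive (≡.sym (ℕ.m∸n+n≡m m≤n)))) ⟩
      G (suc (n ∸ m)) n m x
        ≈⟨ trans (genStirlingᴿ-def n m x) (to-∑ (n ∸ m) λ {i} _ → *-cong (natᴿ-def (coefficient n m i)) (^ᴿ≈^ x i)) ⟨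
      genStirlingᴿ n m x ∎

    product-scale : ∀ n c (b : Fin n → A) → product (λ i → c * b i) ≈ c ^ n * product b
    product-scale zero    c b = sym (*-identityʳ 1#)
    product-scale (suc n) c b = begin
      c * b fzero * product (λ i → c * b (fsuc i))     ≈⟨ *-congˡ (product-scale n c (b ∘ fsuc)) ⟩
      c * b fzero * (c ^ n * product (b ∘ fsuc))       ≈⟨ *-assoc (c * b fzero) (c ^ n) _ ⟨
      c * b fzero * c ^ n * product (b ∘ fsuc)         ≈⟨ *-congʳ (interchange c (b fzero) (c ^ n)) ⟩
      c * c ^ n * b fzero * product (b ∘ fsuc)         ≈⟨ *-assoc (c * c ^ n) (b fzero) _ ⟩
      c * c ^ n * (b fzero * product (b ∘ fsuc))       ∎

    -1^m*-1^m : ∀ m → (- 1#) ^ m * (- 1#) ^ m ≈ 1#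
    -1^m*-1^m m = begin
      (- 1#) ^ m * (- 1#) ^ m   ≈⟨ ^-distrib-* (- 1#) (- 1#) m ⟨
      (- 1# * - 1#) ^ m         ≈⟨ ^-congˡ m (trans (-1*x≈-x (- 1#)) (-‿involutive 1#)) ⟩
      1# ^ m                    ≈⟨ 1^ m ⟩
      1#                        ∎

    sign : ∀ {n m} → m ℕ.≤ n → (- 1#) ^ n * (- 1#) ^ m ≈ (- 1#) ^ (n ∸ m)
    sign {n} {m} m≤n = begin
      (- 1#) ^ n * (- 1#) ^ m                         ≡⟨ ≡.cong (λ k → (- 1#) ^ k * (- 1#) ^ m) (ℕ.m∸n+n≡m m≤n) ⟨
      (- 1#) ^ (n ∸ m ℕ.+ m) * (- 1#) ^ m             ≈⟨ *-congʳ (^-homo-* (- 1#) (n ∸ m) m) ⟩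
      (- 1#) ^ (n ∸ m) * (- 1#) ^ m * (- 1#) ^ m      ≈⟨ *-assoc _ _ _ ⟩
      (- 1#) ^ (n ∸ m) * ((- 1#) ^ m * (- 1#) ^ m)    ≈⟨ *-congˡ (-1^m*-1^m m) ⟩
      (- 1#) ^ (n ∸ m) * 1#                           ≈⟨ *-identityʳ _ ⟩
      (- 1#) ^ (n ∸ m)                                ∎

    fallingFactorial-expansion : ∀ n x y z f → z ≈ - (x + y) → f ≈ productᴿ {n} (λ i → z ⊖ natᴿ (toℕ i)) →
      f ≈ (- 1#) ^ n * ∑ (suc n) (λ m → G (suc n) n m x * y ^ m)
    fallingFactorial-expansion n x y z f z≈ f≈ = begin
      f
        ≈⟨ trans f≈ (productᴿ≈product {n} (λ i → z ⊖ natᴿ (toℕ i))) ⟩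
      product {n} (λ i → z ⊖ natᴿ (toℕ i))
        ≈⟨ product-cong-≋ {n} (λ i → negate (toℕ i)) ⟩
      product {n} (λ i → - 1# * (x + y + nat (toℕ i)))
        ≈⟨ product-scale n (- 1#) (λ i → x + y + nat (toℕ i)) ⟩
      (- 1#) ^ n * risingFactorial (x + y) n
        ≈⟨ *-congˡ (risingFactorial-expansion n n x y ℕ.≤-refl) ⟩
      (- 1#) ^ n * ∑ (suc n) (λ m → G (suc n) n m x * y ^ m) ∎
      where
      negate : ∀ j → (z ⊖ natᴿ j) ≈ - 1# * (x + y + nat j)
      negate j = begin
        z ⊖ natᴿ j               ≈⟨ trans (⊖-def z (natᴿ j)) (+-cong z≈ (-‿cong (natᴿ-def j))) ⟩
        - (x + y) - nat j        ≈⟨ -‿+-comm (x + y) (nat j) ⟩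
        - (x + y + nat j)        ≈⟨ -1*x≈-x _ ⟨
        - 1# * (x + y + nat j)   ∎

  -- The common expansion taken at -y. The sign of (-y)ᵐ combines with (-1)ⁿ to (-1)ⁿ⁻ᵐ, which uses
  -- m ≤ n.
  expansion₁ : ∀ n x y z f → z ≃ (y ⊖ x) → f ≃ productᴿ {n} (λ i → z ⊖ natᴿ (toℕ i)) →
    f ≃ sum≤ᴿ n (λ m → (((⊝ 𝟙) ^ᴿ (n ∸ m)) ⊗ genStirlingᴿ n m x) ⊗ (y ^ᴿ m))
  expansion₁ n x y z f z≈ f≈ = begin
    f
      ≈⟨ fallingFactorial-expansion n x (- y) z f (trans z≈ (trans (⊖-def y x) y-x)) f≈ ⟩
    (- 1#) ^ n * ∑ (suc n) (λ m → G (suc n) n m x * (- y) ^ m)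
      ≈⟨ ∑-* (suc n) ((- 1#) ^ n) (λ m → G (suc n) n m x * (- y) ^ m) ⟨
    ∑ (suc n) (λ m → (- 1#) ^ n * (G (suc n) n m x * (- y) ^ m))
      ≈⟨ to-∑ n (λ m≤n → sym (step m≤n)) ⟨
    sum≤ᴿ n (λ m → ((- 1#) ^ᴿ (n ∸ m)) * genStirlingᴿ n m x * (y ^ᴿ m)) ∎
    where
    y-x : y - x ≈ - (x - y)
    y-x = begin
      y - x         ≈⟨ +-comm y (- x) ⟩
      - x + y       ≈⟨ +-congˡ (-‿involutive y) ⟨
      - x - - y     ≈⟨ -‿+-comm x (- y) ⟩
      - (x - y)     ∎

    step : ∀ {m} → m ℕ.≤ n → (- 1#) ^ n * (G (suc n) n m x * (- y) ^ m) ≈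
      ((- 1#) ^ᴿ (n ∸ m)) * genStirlingᴿ n m x * (y ^ᴿ m)
    step {m} m≤n = begin
      (- 1#) ^ n * (G (suc n) n m x * (- y) ^ m)
        ≈⟨ *-congˡ (*-congˡ (trans (^-congˡ m (sym (-1*x≈-x y))) (^-distrib-* (- 1#) y m))) ⟩
      (- 1#) ^ n * (G (suc n) n m x * ((- 1#) ^ m * y ^ m))
        ≈⟨ *-congˡ (trans (sym (*-assoc _ _ _)) (trans (*-congʳ (*-comm _ _)) (*-assoc _ _ _))) ⟩
      (- 1#) ^ n * ((- 1#) ^ m * (G (suc n) n m x * y ^ m))
        ≈⟨ *-assoc _ _ _ ⟨
      (- 1#) ^ n * (- 1#) ^ m * (G (suc n) n m x * y ^ m)
        ≈⟨ *-cong (trans (sign m≤n) (sym (^ᴿ≈^ (- 1#) (n ∸ m)))) (*-cong (G≈genStirling x m≤n) (sym (^ᴿ≈^ y m))) ⟩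
      ((- 1#) ^ᴿ (n ∸ m)) * (genStirlingᴿ n m x * (y ^ᴿ m))
        ≈⟨ *-assoc _ _ _ ⟨
      ((- 1#) ^ᴿ (n ∸ m)) * genStirlingᴿ n m x * (y ^ᴿ m) ∎

  expansion₂ : ∀ n x y z f → z ≃ ((⊝ x) ⊖ y) → f ≃ productᴿ {n} (λ i → z ⊖ natᴿ (toℕ i)) →
    f ≃ sum≤ᴿ n (λ m → (((⊝ 𝟙) ^ᴿ n) ⊗ genStirlingᴿ n m x) ⊗ (y ^ᴿ m))
  expansion₂ n x y z f z≈ f≈ = begin
    f
      ≈⟨ fallingFactorial-expansion n x y z f (trans z≈ (trans (⊖-def (- x) y) (-‿+-comm x y))) f≈ ⟩
    (- 1#) ^ n * ∑ (suc n) (λ m → G (suc n) n m x * y ^ m)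
      ≈⟨ ∑-* (suc n) ((- 1#) ^ n) (λ m → G (suc n) n m x * y ^ m) ⟨
    ∑ (suc n) (λ m → (- 1#) ^ n * (G (suc n) n m x * y ^ m))
      ≈⟨ to-∑ n (λ {m} m≤n → trans
           (*-cong (*-cong (^ᴿ≈^ (- 1#) n) (sym (G≈genStirling x m≤n))) (^ᴿ≈^ y m)) (*-assoc _ _ _)) ⟨
    sum≤ᴿ n (λ m → ((- 1#) ^ᴿ n) * genStirlingᴿ n m x * (y ^ᴿ m)) ∎

  collect₁ : ∀ n k (s g : ℕ → A) →
    sum≤ᴿ n (λ m → (s m ⊗ g m) ⊗ recip^ᴿ m k) ≃ sum≤ᴿ n (λ m → (s m ⊗ recip^ᴿ m k) ⊗ g m)
  collect₁ n k s g = sum≤ᴿ-cong n λ m → interchange (s m) (g m) (recip^ᴿ m k)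

  collect₂ : ∀ n k s (g : ℕ → A) →
    sum≤ᴿ n (λ m → (s ⊗ g m) ⊗ recip^ᴿ m k) ≃ (s ⊗ sum≤ᴿ n (λ m → recip^ᴿ m k ⊗ g m))
  collect₂ n k s g = begin
    sum≤ᴿ n (λ m → s * g m * recip^ᴿ m k)
      ≈⟨ to-∑ n (λ {m} _ → trans (*-assoc s (g m) (recip^ᴿ m k)) (*-congˡ (*-comm (g m) (recip^ᴿ m k)))) ⟩
    ∑ (suc n) (λ m → s * (recip^ᴿ m k * g m))
      ≈⟨ ∑-* (suc n) s (λ m → recip^ᴿ m k * g m) ⟩
    s * ∑ (suc n) (λ m → recip^ᴿ m k * g m)
      ≈⟨ *-congˡ (sum≤ᴿ≈∑ n _) ⟨
    s * sum≤ᴿ n (λ m → recip^ᴿ m k * g m) ∎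

  PolynomialIntegrable : ((A → A) → A → Set) → Set
  PolynomialIntegrable Integral = ∀ n (a : ℕ → A) f → (∀ t → f t ≃ sum≤ᴿ n (λ m → a m ⊗ (t ^ᴿ m))) →
    ∀ I → I ≃ sum≤ᴿ n (λ m → a m ⊗ recipᴿ (suc m)) → Integral f I

  module Cube
      (Integral : (A → A) → A → Set)
      (polynomial-integrable : PolynomialIntegrable Integral)
      (integral-unique : ∀ f g → (∀ t → 𝟘 ≼ t × t ≼ 𝟙 → f t ≃ g t) →
        ∀ I J → Integral f I → Integral g J → I ≃ J)
      (Iterated : ∀ k → (Vector A k → A) → A → Set)
      (iterated-zero : ∀ f I → f [] ≃ I → Iterated 0 f I)
      (iterated-zero⁻¹ : ∀ f I → Iterated 0 f I → f [] ≃ I)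
      (iterated-suc : ∀ k f I (g : Vector A k → A) →
        (∀ ts → (∀ i → 𝟘 ≼ ts i × ts i ≼ 𝟙) → Integral (λ t → f (t ∷ ts)) (g ts)) →
        Iterated k g I → Iterated (suc k) f I)
      (iterated-suc⁻¹ : ∀ k f I → Iterated (suc k) f I → ∃ λ (g : Vector A k → A) →
        (∀ ts → (∀ i → 𝟘 ≼ ts i × ts i ≼ 𝟙) → Integral (λ t → f (t ∷ ts)) (g ts)) × Iterated k g I)
      (binomialᴿ : A → ℕ → A)
      (binomialᴿ-def : ∀ z n →
        binomialᴿ z n ≃ (productᴿ {n} (λ i → z ⊖ natᴿ (toℕ i)) ⊗ recipᴿ (n !) {{ℕ._!≢0 n}}))
      where

    -- The coefficients are quantified because they change in the induction: `inner`, the result of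
    -- integrating one variable out, is a polynomial of the same shape with `a m * recipᴿ (suc m)`
    -- for `a m`.
    iterated-polynomial : ∀ k n (a : ℕ → A) (f : Vector A k → A) →
      (∀ ts → f ts ≃ sum≤ᴿ n (λ m → a m ⊗ (productᴿ ts ^ᴿ m))) →
      ∀ I → I ≃ sum≤ᴿ n (λ m → a m ⊗ recip^ᴿ m k) → Iterated k f I
    iterated-polynomial zero n a f f≈ I I≈ = iterated-zero f I
      (cube-zero n a (productᴿ []) (f []) I (productᴿ-zero []) (f≈ []) I≈)
    iterated-polynomial (suc k) n a f f≈ I I≈ = iterated-suc k f I inner
      (λ ts _ → polynomial-integrable n (λ m → a m * (productᴿ ts ^ᴿ m)) (λ t → f (t ∷ ts))
        (λ t → cube-integrand n a (productᴿ (t ∷ ts)) t (productᴿ ts) (f (t ∷ ts))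
          (productᴿ-suc (t ∷ ts)) (f≈ (t ∷ ts)))
        (inner ts) (cube-inner n a (productᴿ ts)))
      (iterated-polynomial k n (λ m → a m * recipᴿ (suc m)) inner (λ _ → refl) I
        (trans I≈ (cube-value n k a)))
      where
      inner : Vector A k → A
      inner ts = sum≤ᴿ n λ m → a m * recipᴿ (suc m) * (productᴿ ts ^ᴿ m)

    -- Two functions are needed even to compare two integrals of one: the inner functions behind the
    -- two integrals may be different and are tied together on the cube only.
    iterated-unique : ∀ k (f g : Vector A k → A) →
      (∀ ts → (∀ i → 𝟘 ≼ ts i × ts i ≼ 𝟙) → f ts ≃ g ts) →
      ∀ I J → Iterated k f I → Iterated k g J → I ≃ J
    iterated-unique zero f g h I J p q =
      trans (sym (iterated-zero⁻¹ f I p)) (trans (h [] λ ()) (iterated-zero⁻¹ g J q))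
    iterated-unique (suc k) f g h I J p q =
      let f′ , hf , p′ = iterated-suc⁻¹ k f I p
          g′ , hg , q′ = iterated-suc⁻¹ k g J q
      in iterated-unique k f′ g′
           (λ ts ts∈ → integral-unique (λ t → f (t ∷ ts)) (λ t → g (t ∷ ts))
             (λ t t∈ → h (t ∷ ts) λ { fzero → t∈ ; (fsuc i) → ts∈ i })
             (f′ ts) (g′ ts) (hf ts ts∈) (hg ts ts∈))
           I J p′ q′

    -- Both kinds at once, `z` being the argument of the binomial as a function of the product. The
    -- explicit integral `I₀` is the witness for one direction; in the other, uniqueness identifies
    -- any given integral with it.
    polyCauchy : ∀ n k (a : ℕ → A) (z : A → A) →
      (∀ y f → f ≃ productᴿ {n} (λ i → z y ⊖ natᴿ (toℕ i)) → f ≃ sum≤ᴿ n (λ m → a m ⊗ (y ^ᴿ m))) →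
      ∀ R → sum≤ᴿ n (λ m → a m ⊗ recip^ᴿ m k) ≃ R → ∀ c →
      (∃ λ I → Iterated k (λ ts → binomialᴿ (z (productᴿ ts)) n) I × c ≃ (natᴿ (n !) ⊗ I)) ⇔ c ≃ R
    polyCauchy n k a z expansion R R≈ c = mk⇔
      (λ (I , p , c≈) → trans c≈ (trans (*-congˡ (iterated-unique k F F (λ _ _ → refl) I I₀ p p₀)) n!I₀))
      (λ c≈R → I₀ , p₀ , trans c≈R (sym n!I₀))
      where
      instance
        n!≢0 : ℕ.NonZero (n !)
        n!≢0 = ℕ._!≢0 n

      F : Vector A k → A
      F ts = binomialᴿ (z (productᴿ ts)) n

      I₀ : A
      I₀ = sum≤ᴿ n λ m → a m * recipᴿ (n !) * recip^ᴿ m k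

      p₀ : Iterated k F I₀
      p₀ = iterated-polynomial k n (λ m → a m * recipᴿ (n !)) F
        (λ ts → trans (binomialᴿ-def (z (productᴿ ts)) n)
          (scaled-expansion n a _ (productᴿ ts) (recipᴿ (n !)) (expansion (productᴿ ts) _ refl)))
        I₀ refl

      n!I₀ : natᴿ (n !) * I₀ ≈ R
      n!I₀ = trans (unscale n k a (n !)) R≈

    polyCauchy₁ : ∀ n k x c →
      (∃ λ I → Iterated k (λ ts → binomialᴿ (productᴿ ts ⊖ x) n) I × c ≃ (natᴿ (n !) ⊗ I)) ⇔
      c ≃ sum≤ᴿ n (λ m → (((⊝ 𝟙) ^ᴿ (n ∸ m)) ⊗ recip^ᴿ m k) ⊗ genStirlingᴿ n m x)
    polyCauchy₁ n k x = polyCauchy n k (λ m → ((- 1#) ^ᴿ (n ∸ m)) * genStirlingᴿ n m x) (_⊖ x)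
      (λ y f → expansion₁ n x y (y ⊖ x) f refl) _
      (collect₁ n k (λ m → (- 1#) ^ᴿ (n ∸ m)) (λ m → genStirlingᴿ n m x))

    polyCauchy₂ : ∀ n k x c →
      (∃ λ I → Iterated k (λ ts → binomialᴿ ((⊝ x) ⊖ productᴿ ts) n) I × c ≃ (natᴿ (n !) ⊗ I)) ⇔
      c ≃ (((⊝ 𝟙) ^ᴿ n) ⊗ sum≤ᴿ n (λ m → recip^ᴿ m k ⊗ genStirlingᴿ n m x))
    polyCauchy₂ n k x = polyCauchy n k (λ m → ((- 1#) ^ᴿ n) * genStirlingᴿ n m x) (λ y → (- x) ⊖ y)
      (λ y f → expansion₂ n x y ((- x) ⊖ y) f refl) _
      (collect₂ n k ((- 1#) ^ᴿ n) (λ m → genStirlingᴿ n m x))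

-- Instantiation at the Cauchy reals.

open import Defs
open ℝ-Properties using (≈-refl; ℝ-isOrderedℚAlgebra)

module ℝR = Restatement ℝ-isOrderedℚAlgebra
  _-_ (λ x y → ≈-refl (x - y))
  natℝ (λ n → ≈-refl (natℝ n))
  (λ d → 1/ℕ d) (λ d → ≈-refl (1/ℕ d))
  sum (λ v → ≈-refl 0ℝ) (λ v → ≈-refl (sum v))
  product (λ v → ≈-refl 1ℝ) (λ v → ≈-refl (product v))
  _^_ (λ x → ≈-refl 1ℝ) (λ x n → ≈-refl (x ^ suc n))
  sum≤ (λ n a → ≈-refl (sum≤ n a))
  genStirling₁ (λ n m x → ≈-refl (genStirling₁ n m x))
  1/[1+_]^_ (λ m k → ≈-refl (1/[1+ m ]^ k))

fine-partition : ∀ {δ δ′} → 0ℚ ℚ.< δ → 0ℚ ℚ.< δ′ → ∃ λ r → ∃ λ (P : TaggedPartition r) →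
  (∀ i → tag P i ∈[0,1]) × (∀ i → width P i ≤ fromℚ δ) × (∀ i → width P i ≤ fromℚ δ′)
fine-partition {δ} {δ′} 0<δ 0<δ′ = pack (ℝR.uniform-partition {δ} {δ′} 0<δ 0<δ′)
  where
  pack : (∃ λ r → ∃ λ (x : Fin (suc r) → ℝ) → ∃ λ (τ : Fin r → ℝ) →
    x fzero ≈ 0ℝ × x (flast r) ≈ 1ℝ × (∀ i → x (inject₁ i) ≤ τ i) × (∀ i → τ i ≤ x (fsuc i)) ×
    (∀ i → 0ℝ ≤ τ i × τ i ≤ 1ℝ) × (∀ i → (x (fsuc i) - x (inject₁ i)) ≤ fromℚ δ) ×
    (∀ i → (x (fsuc i) - x (inject₁ i)) ≤ fromℚ δ′)) →
    ∃ λ r → ∃ λ (P : TaggedPartition r) →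
    (∀ i → tag P i ∈[0,1]) × (∀ i → width P i ≤ fromℚ δ) × (∀ i → width P i ≤ fromℚ δ′)
  pack (r , x , τ , x0 , x1 , lo , up , τ∈ , w≤δ , w≤δ′) =
    r , record { point = x ; tag = τ ; first = x0 ; last = x1 ; lower = lo ; upper = up } , τ∈ , w≤δ , w≤δ′

-- One partition, fine enough for both integrals and with tags in [0,1], gives equal Riemann sums
-- for `f` and `g`, close to `I` and to `J` respectively.
integral-unique : ∀ f g → (∀ t → t ∈[0,1] → f t ≈ g t) → ∀ I J → Integral₀¹ f I → Integral₀¹ g J → I ≈ J
integral-unique f g h I J p q = ℝR.limits-agree {I} {J} λ ε 0<ε →
  let δ , 0<δ , pδ = p ε 0<ε
      δ′ , 0<δ′ , qδ′ = q ε 0<ε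
      r , P , τ∈ , w≤δ , w≤δ′ = fine-partition 0<δ 0<δ′
  in riemannSum f P , riemannSum g P , agree P τ∈ , pδ P w≤δ , qδ′ P w≤δ′
  where
  agree : ∀ {r} (P : TaggedPartition r) → (∀ i → tag P i ∈[0,1]) → riemannSum f P ≈ riemannSum g P
  agree P τ∈ = ℝR.riemann-sum-cong f g (tag P) (width P) (λ i → h (tag P i) (τ∈ i))
    (riemannSum f P) (riemannSum g P) (≈-refl (riemannSum f P)) (≈-refl (riemannSum g P))

polynomial-integrable : ℝR.PolynomialIntegrable Integral₀¹
polynomial-integrable n a f f≈ I I≈ ε 0<ε =
  let δ , 0<δ , close = ℝR.polynomial-integral n a f f≈ I I≈ ε 0<ε
  in δ , 0<δ , λ P w≤δ → close (point P) (tag P) (width P) (riemannSum f P)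
       (first P) (last P) (lower P) (upper P) (λ i → ≈-refl (width P i)) (≈-refl (riemannSum f P)) w≤δ

module ℝC = ℝR.Cube
  Integral₀¹ polynomial-integrable
  integral-unique
  IteratedIntegral
  (λ _ _ p → p) (λ _ _ p → p)
  (λ _ _ _ g p q → g , p , q) (λ _ _ _ p → p)
  binomial (λ z n → ≈-refl (binomial z n))

-- Defs._^_ is a second name for the library's _^_, to which the instantiation above
-- resolves it.  Comparing the two names in place would unfold the sums around them.
transport : ∀ (P : (ℝ → ℕ → ℝ) → Set) → P (RawSemiringDefs._^_ (RawRing.rawSemiring +-*-rawRing)) → P _^_
transport P p = p

-- The claim with the power operation abstracted, as the predicate along which `transport` exchanges
-- the two names.
Proposition6 : (n k : ℕ) (x : ℝ) → (ℝ → ℕ → ℝ) → Set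
Proposition6 n k x _^′_ =
    (∀ c → IsPolyCauchy₁ n k x c ⇔
    (c ≈ (Σ[ m ≤ n ] (- 1ℝ) ^′ (n ∸ m) * 1/[1+ m ]^ k * genStirling₁ n m x)))
    × (∀ c → IsPolyCauchy₂ n k (- x) c ⇔
    (c ≈ (- 1ℝ) ^′ n * (Σ[ m ≤ n ] 1/[1+ m ]^ k * genStirling₁ n m x)))

proposition6 : (n k : ℕ) → 1 ≤ℕ k → (x : ℝ) →
    (∀ c → IsPolyCauchy₁ n k x c ⇔
    (c ≈ (Σ[ m ≤ n ] (- 1ℝ) ^ (n ∸ m) * 1/[1+ m ]^ k * genStirling₁ n m x)))
    × (∀ c → IsPolyCauchy₂ n k (- x) c ⇔
    (c ≈ (- 1ℝ) ^ n * (Σ[ m ≤ n ] 1/[1+ m ]^ k * genStirling₁ n m x)))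
proposition6 n k _ x = transport (Proposition6 n k x) (ℝC.polyCauchy₁ n k x , ℝC.polyCauchy₂ n k x)
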